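{- Let $I=(W,F,E,\{\mathcal{L}_a,q_a,P_a\}_{a\in W\cup F})$ be an SMTI-LC instance with $E=\{e_1,\dots,e_n\}$, let $I^*$ be its auxiliary instance with contract set $E^*=\{x_i,y_i,z_i \mid i=1,\dots,n\}$, and let $\pi:2^{E^*}\to 2^{E}$ be the map $\pi(S^*)=\{e_i \mid \{x_i,y_i,z_i\}\cap S^*\neq\emptyset\}$. For a stable matching $M^*$ of $I^*$, let $M:=\pi(M^*)$. Then $M$ is a stable matching of $I$ with $|M|\ge \frac{2}{3}|M_{\rm OPT}|$, where $M_{\rm OPT}$ is a maximum-cardinality stable matching of $I$.
   Context: Notation: $S+e:=S\cup\{e\}$, $S-e:=S\setminus\{e\}$; $\mathbf{Z}_+$ is the set of non-negative integers. A family of sets is laminar if any two members $L,L'$ satisfy $L\subseteq L'$, $L\supseteq L'$ or $L\cap L'=\emptyset$. SMTI-LC instance. A tuple $I=(W,F,E,\{\mathcal{L}_a,q_a,P_a\}_{a\in W\cup F})$, where $W$ (workers) and $F$ (firms) are disjoint finite sets, whose elements are called agents, and $E$ is a finite set of contracts. Each $e\in E$ is associated with one worker $\partial_W(e)\in W$ and one firm $\partial_F(e)\in F$; several contracts may be associated with the same pair. Put $E_w=\{e\in E\mid \partial_W(e)=w\}$ for $w\in W$ and $E_f=\{e\in E\mid\partial_F(e)=f\}$ for $f\in F$. Each agent $a$ has a laminar family $\mathcal{L}_a$ of subsets of $E_a$, a quota function $q_a:\mathcal{L}_a\to\mathbf{Z}_+$, and a preference list $P_a$ consisting of all elements of $E_a$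 and possibly containing ties (i.e. a ranking of $E_a$ by a total preorder). Write $e\succ_a e'$ if $a$ strictly prefers $e$ to $e'$ according to $P_a$. Matchings and stability. For $M\subseteq E$ let $M_a:=M\cap E_a$. $M$ is feasible for $a$ if $|M_a\cap L|\le q_a(L)$ for all $L\in\mathcal{L}_a$. $M$ is a matching if it is feasible for all agents. For a matching $M$, a contract $e\in E\setminus M$ and $a\in\{\partial_W(e),\partial_F(e)\}$, $e$ is free for $a$ in $M$ if $M_a+e$ is feasible for $a$, or there is $e'\in M_a$ such that $e\succ_a e'$ and $M_a+e-e'$ is feasible for $a$. A contract $e\in E\setminus M$ blocks $M$ if it is free for both $\partial_W(e)$ and $\partial_F(e)$. A matching is stable if no contract of $E\setminus M$ blocks it. Auxiliary instance. Given $I$ with $E=\{e_1,\dots,e_n\}$, the auxiliary instance $I^*=(W,F,E^*,\{\mathcal{L}^*_a,q^*_a,P^*_a\}_{a\in W\cup F})$ is the following SMTI-LC instance without ties. The contract set is $E^*=\{x_i,y_i,z_i\mid i=1,\dots,n\}$, where $x_i,y_i,z_i$ are copies of $e_i$, associated with the same worker and the same firm as $e_i$. For each agent $a$, $\mathcal{L}^*_a$ consists exactly of the sets $\{x_i,y_i,z_i\}$ for $e_i\in E_a$, with quota $q^*_a=1$, and the sets $L^*:=\{x_i,y_i,z_i\mid e_i\in L\}$ for $L\in\mathcal{L}_a$, with quota $q^*_a(L^*)=q_a(L)$ (if $L=\{e_i\}$, both bounds are imposed on $\{x_i,y_i,z_i\}$). Thus $M^*\subseteq E^*$ is feasible for $a$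 in $I^*$ if and only if $M^*$ contains at most one copy of each $e_i\in E_a$ and $\pi(M^*)$ is feasible for $a$ in $I$. Preference lists in $I^*$: each list $P_a$ is written from most to least preferred, with the elements of each tie written in some (arbitrary) order. For a worker $w$, $P^*_w$ is obtained as follows: replace each tie $(e_{i_1}\,e_{i_2}\cdots e_{i_\ell})$ of $P_w$ (a contract not in any tie being regarded as a tie of length one) by the strict sequence $x_{i_1}x_{i_2}\cdots x_{i_\ell}\,y_{i_1}y_{i_2}\cdots y_{i_\ell}$; then, at the end of the resulting list, append the list $P_w$ with each $e_i$ replaced by $z_i$ and all tie parentheses omitted. For a firm $f$, $P^*_f$ is defined in the same manner with the roles of $x_i$ and $z_i$ interchanged: each tie $(e_{i_1}\cdots e_{i_\ell})$ of $P_f$ is replaced by $z_{i_1}\cdots z_{i_\ell}\,y_{i_1}\cdots y_{i_\ell}$, and then the list $P_f$ with each $e_i$ replaced by $x_i$ and parentheses omitted is appended at the end. -}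

module Defs where

open import Data.Bool.Base using (Bool; true)
open import Data.Fin.Base using (Fin; combine; remQuot)
open import Data.Fin.Patterns using (0F; 1F; 2F)
import Data.Fin.Properties as Fin
open import Data.Fin.Subset
open import Data.Fin.Subset.Properties using (_∈?_; nonempty?; x∈⁅x⁆; x∈⁅y⁆⇒x≡y; x∈p∪q⁺; x∈p∪q⁻; x∈p∩q⁺; x∈p∩q⁻)
open import Data.List.Base using (List; []; _∷_; [_]; _++_; map; concat; concatMap; filter; allFin)
open import Data.List.Properties using (concat-map-[_])
open import Data.List.Membership.Propositional using () renaming (_∈_ to _∈ₗ_)
open import Data.List.Membership.Propositional.Properties using (∈-map⁺; ∈-map⁻; ∈-++⁺ˡ; ∈-++⁺ʳ; ∈-++⁻)
open import Data.List.Relation.Unary.All using (All)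
import Data.List.Relation.Unary.All.Properties as All
import Data.List.Relation.Unary.All as All
open import Data.List.Relation.Unary.AllPairs using ([]; _∷_)
import Data.List.Relation.Unary.Any as Any
open import Data.List.Relation.Unary.Unique.Propositional using (Unique)
import Data.List.Relation.Unary.Unique.Propositional.Properties as Unique
open import Data.Nat.Base using (ℕ; _≤_; _*_)
open import Data.Product.Base using (∃; _×_; _,_; proj₁; proj₂; map₁)
open import Data.Sum.Base using (_⊎_; inj₁; inj₂; [_,_]′)
open import Data.Vec.Base using (lookup; tabulate)
open import Data.Vec.Properties using (lookup∘tabulate; []=⇒lookup; lookup⇒[]=)
open import Function.Base using (_∘_; id)
open import Function.Bundles using (_⇔_; mk⇔; Equivalence)
open import Relation.Binary.PropositionalEquality using (_≡_; _≢_; refl; sym; trans; cong; subst)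
open import Relation.Nullary using (¬_; does; yes; no)

private variable
  n : ℕ

Nested : Subset n → Subset n → Set
Nested L L′ = L ⊆ L′ ⊎ L ⊇ L′ ⊎ Empty (L ∩ L′)

Laminar : List (Subset n) → Set
Laminar F = ∀ {L L′} → L ∈ₗ F → L′ ∈ₗ F → Nested L L′

-- A preference list is a list of ties, from most to least preferred, a
-- contract not in any tie forming a tie of length one.  The order in which
-- a tie is written carries no preference, but is used by the auxiliary
-- instance below.
PrefList : ℕ → Set
PrefList n = List (List (Fin n))

data _⊢_≻_ {n} : PrefList n → Fin n → Fin n → Set where
  here  : ∀ {T Ts e e′} → e ∈ₗ T → e′ ∈ₗ concat Ts → (T ∷ Ts) ⊢ e ≻ e′
  there : ∀ {T Ts e e′} → Ts ⊢ e ≻ e′ → (T ∷ Ts) ⊢ e ≻ e′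

record SMTI-LC (nW nF n : ℕ) : Set where
  field
    ∂W : Fin n → Fin nW
    ∂F : Fin n → Fin nF

  Agent : Set
  Agent = Fin nW ⊎ Fin nF

  E : Agent → Subset n
  E = [ (λ w → tabulate (λ e → does (∂W e Fin.≟ w)))
      , (λ f → tabulate (λ e → does (∂F e Fin.≟ f))) ]′

  field
    -- The family of an agent together with its quota function, as pairs
    -- (L , q L).  A set listed with two quotas is subject to both bounds;
    -- this happens in the auxiliary instance.
    𝓛          : Agent → List (Subset n × ℕ)
    𝓛⊆E        : ∀ a → All (λ (L , _) → L ⊆ E a) (𝓛 a)
    𝓛-laminar  : ∀ a → Laminar (map proj₁ (𝓛 a))
    P          : Agent → PrefList n
    P-nonempty : ∀ a → All (_≢ []) (P a)
    P-unique   : ∀ a → Unique (concat (P a))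
    P-complete : ∀ a {e} → e ∈ₗ concat (P a) ⇔ e ∈ E a

  Feasible : Agent → Subset n → Set
  Feasible a M = All (λ (L , q) → ∣ (M ∩ E a) ∩ L ∣ ≤ q) (𝓛 a)

  Matching : Subset n → Set
  Matching M = ∀ a → Feasible a M

  Free : Subset n → Fin n → Agent → Set
  Free M e a =
      Feasible a (Mₐ ∪ ⁅ e ⁆)
    ⊎ (∃ λ e′ → e′ ∈ Mₐ × P a ⊢ e ≻ e′ × Feasible a ((Mₐ ∪ ⁅ e ⁆) - e′))
    where
    Mₐ : Subset n
    Mₐ = M ∩ E a

  Blocks : Fin n → Subset n → Set
  Blocks e M = e ∉ M × Free M e (inj₁ (∂W e)) × Free M e (inj₂ (∂F e))

  Stable : Subset n → Set
  Stable M = Matching M × (∀ e → ¬ Blocks e M)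

  MaxStable : Subset n → Set
  MaxStable M = Stable M × (∀ N → Stable N → ∣ N ∣ ≤ ∣ M ∣)

∈-tabulate⁺ : ∀ {f : Fin n → Bool} {i} → f i ≡ true → i ∈ tabulate f
∈-tabulate⁺ {f = f} {i} eq = lookup⇒[]= i _ (trans (lookup∘tabulate f i) eq)

∈-tabulate⁻ : ∀ {f : Fin n → Bool} {i} → i ∈ tabulate f → f i ≡ true
∈-tabulate⁻ {f = f} {i} p = trans (sym (lookup∘tabulate f i)) ([]=⇒lookup p)

nested-sym : ∀ {L L′ : Subset n} → Nested L L′ → Nested L′ L
nested-sym (inj₁ p) = inj₂ (inj₁ p)
nested-sym (inj₂ (inj₁ p)) = inj₁ p
nested-sym {L = L} {L′} (inj₂ (inj₂ p)) = inj₂ (inj₂ λ (i , q) →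
  let i∈L′ , i∈L = x∈p∩q⁻ L′ L q in p (i , x∈p∩q⁺ (i∈L , i∈L′)))

cover-worker : ∀ (b : Fin 3) → b ≡ 0F ⊎ b ≡ 1F ⊎ b ≡ 2F
cover-worker 0F = inj₁ refl
cover-worker 1F = inj₂ (inj₁ refl)
cover-worker 2F = inj₂ (inj₂ refl)

cover-firm : ∀ (b : Fin 3) → b ≡ 2F ⊎ b ≡ 1F ⊎ b ≡ 0F
cover-firm 0F = inj₂ (inj₂ refl)
cover-firm 1F = inj₂ (inj₁ refl)
cover-firm 2F = inj₁ refl

-- Contracts of the auxiliary instance: Fin (n * 3) ≅ Fin n × Fin 3.  As
-- _*_ is not injective for unification, n is an explicit parameter.
module Copies (n : ℕ) where

  copy : Fin 3 → Fin n → Fin (n * 3)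
  copy c i = combine i c

  x y z : Fin n → Fin (n * 3)
  x = copy 0F
  y = copy 1F
  z = copy 2F

  -- The contract of which k is a copy.
  orig : Fin (n * 3) → Fin n
  orig k = proj₁ (remQuot 3 k)

  copies : Fin n → Subset (n * 3)
  copies i = ⁅ x i ⁆ ∪ ⁅ y i ⁆ ∪ ⁅ z i ⁆

  star : Subset n → Subset (n * 3)
  star L = tabulate (λ k → lookup L (orig k))

  π : Subset (n * 3) → Subset n
  π S = tabulate (λ i → does (nonempty? (copies i ∩ S)))

  -- first i₁ … first iₗ y i₁ … y iₗ for each tie (i₁ … iₗ), followed by all
  -- contracts in their written order, replaced by their copies under last.
  strictify : (first last : Fin n → Fin (n * 3)) → PrefList n → List (Fin (n * 3))
  strictify first last Ts =
    concatMap (λ T → map first T ++ map y T) Ts ++ map last (concat Ts)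

  orig-copy : ∀ c (i : Fin n) → orig (copy c i) ≡ i
  orig-copy c i = cong proj₁ (Fin.remQuot-combine i c)

  copy-orig : (k : Fin (n * 3)) → ∃ λ c → copy c (orig k) ≡ k
  copy-orig k = _ , Fin.combine-remQuot {n} 3 k

  copy-injective : ∀ c {i j : Fin n} → copy c i ≡ copy c j → i ≡ j
  copy-injective c {i} {j} = Fin.combine-injectiveˡ i c j c

  ∈-star⁺ : ∀ {L : Subset n} {k} → orig k ∈ L → k ∈ star L
  ∈-star⁺ p = ∈-tabulate⁺ ([]=⇒lookup p)

  ∈-star⁻ : ∀ {L : Subset n} {k} → k ∈ star L → orig k ∈ L
  ∈-star⁻ {L = L} {k} p = lookup⇒[]= (orig k) L (∈-tabulate⁻ p)

  ∈-copies⁻ : ∀ {i : Fin n} {k} → k ∈ copies i → orig k ≡ i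
  ∈-copies⁻ {i = i} p with x∈p∪q⁻ ⁅ x i ⁆ _ p
  ... | inj₁ q = trans (cong orig (x∈⁅y⁆⇒x≡y _ q)) (orig-copy 0F i)
  ... | inj₂ q with x∈p∪q⁻ ⁅ y i ⁆ _ q
  ...   | inj₁ r = trans (cong orig (x∈⁅y⁆⇒x≡y _ r)) (orig-copy 1F i)
  ...   | inj₂ r = trans (cong orig (x∈⁅y⁆⇒x≡y _ r)) (orig-copy 2F i)

  copy∈copies : ∀ c (i : Fin n) → copy c i ∈ copies i
  copy∈copies 0F i = x∈p∪q⁺ (inj₁ (x∈⁅x⁆ (x i)))
  copy∈copies 1F i = x∈p∪q⁺ {p = ⁅ x i ⁆} (inj₂ (x∈p∪q⁺ (inj₁ (x∈⁅x⁆ (y i)))))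
  copy∈copies 2F i = x∈p∪q⁺ {p = ⁅ x i ⁆} (inj₂ (x∈p∪q⁺ {p = ⁅ y i ⁆} (inj₂ (x∈⁅x⁆ (z i)))))

  ∈-copies⁺ : ∀ {i : Fin n} {k} → orig k ≡ i → k ∈ copies i
  ∈-copies⁺ {k = k} refl =
    let c , eq = copy-orig k in subst (_∈ copies (orig k)) eq (copy∈copies c (orig k))

  star-⊆ : ∀ {L L′ : Subset n} → L ⊆ L′ → star L ⊆ star L′
  star-⊆ L⊆L′ = ∈-star⁺ ∘ L⊆L′ ∘ ∈-star⁻

  copies-⊆ : ∀ {i} {L : Subset n} → i ∈ L → copies i ⊆ star L
  copies-⊆ {L = L} i∈L p = ∈-star⁺ (subst (_∈ L) (sym (∈-copies⁻ p)) i∈L)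

  nested-star : ∀ {L L′ : Subset n} → Nested L L′ → Nested (star L) (star L′)
  nested-star (inj₁ p) = inj₁ (star-⊆ p)
  nested-star (inj₂ (inj₁ p)) = inj₂ (inj₁ (star-⊆ p))
  nested-star {L = L} {L′} (inj₂ (inj₂ p)) = inj₂ (inj₂ λ (k , q) →
    let k∈L , k∈L′ = x∈p∩q⁻ (star L) (star L′) q
    in p (orig k , x∈p∩q⁺ (∈-star⁻ k∈L , ∈-star⁻ k∈L′)))

  nested-copies-star : ∀ i (L : Subset n) → Nested (copies i) (star L)
  nested-copies-star i L with i ∈? L
  ... | yes i∈L = inj₁ (copies-⊆ i∈L)
  ... | no  i∉L = inj₂ (inj₂ λ (k , q) →
    let k∈i , k∈L = x∈p∩q⁻ (copies i) (star L) q
    in i∉L (subst (_∈ L) (∈-copies⁻ k∈i) (∈-star⁻ k∈L)))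

  nested-copies : ∀ (i j : Fin n) → Nested (copies i) (copies j)
  nested-copies i j with i Fin.≟ j
  ... | yes refl = inj₁ id
  ... | no  i≢j  = inj₂ (inj₂ λ (k , q) →
    let k∈i , k∈j = x∈p∩q⁻ (copies i) (copies j) q
    in i≢j (trans (sym (∈-copies⁻ k∈i)) (∈-copies⁻ k∈j)))

  -- strictify (copy c) (copy d) lists every copy exactly once when c, 1F, d
  -- enumerate Fin 3.
  module Strictify (c d : Fin 3) (c≢1 : c ≢ 1F) (d≢c : d ≢ c) (d≢1 : d ≢ 1F)
                   (cover : ∀ b → b ≡ c ⊎ b ≡ 1F ⊎ b ≡ d) where

    block : List (Fin n) → List (Fin (n * 3))
    block T = map (copy c) T ++ map y T

    copy-disjoint : ∀ {b b′} {i j : Fin n} → b ≢ b′ → copy b i ≢ copy b′ j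
    copy-disjoint {b} {b′} {i} {j} b≢b′ eq = b≢b′ (Fin.combine-injectiveʳ i b j b′ eq)

    map-∈ : ∀ b {T : List (Fin n)} {k} → k ∈ₗ map (copy b) T → orig k ∈ₗ T
    map-∈ b {T} p with i , i∈T , refl ← ∈-map⁻ (copy b) p =
      subst (_∈ₗ T) (sym (orig-copy b i)) i∈T

    map-disjoint : ∀ b b′ {T U : List (Fin n)} {k} → b ≢ b′ →
                   k ∈ₗ map (copy b) T → ¬ (k ∈ₗ map (copy b′) U)
    map-disjoint b b′ b≢b′ p q
      with i , _ , refl ← ∈-map⁻ (copy b) p
      with j , _ , eq ← ∈-map⁻ (copy b′) q = copy-disjoint b≢b′ eq

    block-∈ : ∀ T {k} → k ∈ₗ block T → orig k ∈ₗ T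
    block-∈ T p with ∈-++⁻ (map (copy c) T) p
    ... | inj₁ q = map-∈ c q
    ... | inj₂ q = map-∈ 1F q

    blocks-∈ : ∀ Ts {k} → k ∈ₗ concatMap block Ts → orig k ∈ₗ concat Ts
    blocks-∈ (T ∷ Ts) p with ∈-++⁻ (block T) p
    ... | inj₁ q = ∈-++⁺ˡ (block-∈ T q)
    ... | inj₂ q = ∈-++⁺ʳ T (blocks-∈ Ts q)

    blocks-∌last : ∀ Ts {U k} → k ∈ₗ concatMap block Ts → ¬ (k ∈ₗ map (copy d) U)
    blocks-∌last (T ∷ Ts) p r with ∈-++⁻ (block T) p
    ... | inj₂ q = blocks-∌last Ts q r
    ... | inj₁ q with ∈-++⁻ (map (copy c) T) q
    ...   | inj₁ s = map-disjoint d c d≢c r s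
    ...   | inj₂ s = map-disjoint d 1F d≢1 r s

    blocks-∋ : ∀ Ts {i} b → b ≡ c ⊎ b ≡ 1F → i ∈ₗ concat Ts → copy b i ∈ₗ concatMap block Ts
    blocks-∋ (T ∷ Ts) b b≡ p with ∈-++⁻ T p
    ... | inj₂ q = ∈-++⁺ʳ (block T) (blocks-∋ Ts b b≡ q)
    blocks-∋ (T ∷ Ts) b (inj₁ refl) p | inj₁ q = ∈-++⁺ˡ (∈-++⁺ˡ (∈-map⁺ (copy c) q))
    blocks-∋ (T ∷ Ts) b (inj₂ refl) p | inj₁ q = ∈-++⁺ˡ (∈-++⁺ʳ (map (copy c) T) (∈-map⁺ y q))

    sound : ∀ Ts {k} → k ∈ₗ strictify (copy c) (copy d) Ts → orig k ∈ₗ concat Ts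
    sound Ts p with ∈-++⁻ (concatMap block Ts) p
    ... | inj₁ q = blocks-∈ Ts q
    ... | inj₂ q = map-∈ d q

    complete : ∀ Ts {k} → orig k ∈ₗ concat Ts → k ∈ₗ strictify (copy c) (copy d) Ts
    complete Ts {k} p with b , eq ← copy-orig k with cover b
    ... | inj₁ b≡c = ∈-++⁺ˡ (subst (_∈ₗ _) eq (blocks-∋ Ts b (inj₁ b≡c) p))
    ... | inj₂ (inj₁ b≡1) = ∈-++⁺ˡ (subst (_∈ₗ _) eq (blocks-∋ Ts b (inj₂ b≡1) p))
    ... | inj₂ (inj₂ refl) =
      ∈-++⁺ʳ (concatMap block Ts) (subst (_∈ₗ _) eq (∈-map⁺ (copy d) p))

    unique-++⁻ : ∀ (T : List (Fin n)) {U} → Unique (T ++ U) →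
                 Unique T × Unique U × (∀ {i} → i ∈ₗ T → ¬ (i ∈ₗ U))
    unique-++⁻ []      u        = [] , u , λ ()
    unique-++⁻ (i ∷ T) (i∉ ∷ u) =
      let uT , uU , disj = unique-++⁻ T u
      in All.++⁻ˡ T i∉ ∷ uT , uU , λ where
           (Any.here refl) j∈U → All.lookup (All.++⁻ʳ T i∉) j∈U refl
           (Any.there j∈T) j∈U → disj j∈T j∈U

    blocks-unique : ∀ Ts → Unique (concat Ts) → Unique (concatMap block Ts)
    blocks-unique []       u = []
    blocks-unique (T ∷ Ts) u =
      let uT , uTs , disj = unique-++⁻ T u
      in Unique.++⁺
           (Unique.++⁺ (Unique.map⁺ (copy-injective c) uT) (Unique.map⁺ (copy-injective 1F) uT)
             (λ (p , q) → map-disjoint c 1F c≢1 p q))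
           (blocks-unique Ts uTs)
           (λ (p , q) → disj (block-∈ T p) (blocks-∈ Ts q))

    unique : ∀ Ts → Unique (concat Ts) → Unique (strictify (copy c) (copy d) Ts)
    unique Ts u = Unique.++⁺ (blocks-unique Ts u) (Unique.map⁺ (copy-injective d) u)
      (λ (p , q) → blocks-∌last Ts p q)

  module WorkerList = Strictify 0F 2F (λ ()) (λ ()) (λ ()) cover-worker
  module FirmList = Strictify 2F 0F (λ ()) (λ ()) (λ ()) cover-firm

module Auxiliary {nW nF n : ℕ} (I : SMTI-LC nW nF n) where
  open SMTI-LC I
  open Copies n

  𝓛* : Agent → List (Subset (n * 3) × ℕ)
  𝓛* a = map (λ i → copies i , 1) (filter (_∈? E a) (allFin n))
      ++ map (map₁ star) (𝓛 a)

  list* : Agent → List (Fin (n * 3))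
  list* (inj₁ w) = strictify x z (P (inj₁ w))
  list* (inj₂ f) = strictify z x (P (inj₂ f))

  P* : Agent → PrefList (n * 3)
  P* a = map [_] (list* a)

  E* : Agent → Subset (n * 3)
  E* = [ (λ w → tabulate (λ k → does (∂W (orig k) Fin.≟ w)))
       , (λ f → tabulate (λ k → does (∂F (orig k) Fin.≟ f))) ]′

  ∈-E*⁺ : ∀ a {k} → orig k ∈ E a → k ∈ E* a
  ∈-E*⁺ (inj₁ w) p = ∈-tabulate⁺ (∈-tabulate⁻ p)
  ∈-E*⁺ (inj₂ f) p = ∈-tabulate⁺ (∈-tabulate⁻ p)

  ∈-E*⁻ : ∀ a {k} → k ∈ E* a → orig k ∈ E a
  ∈-E*⁻ (inj₁ w) p = ∈-tabulate⁺ (∈-tabulate⁻ p)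
  ∈-E*⁻ (inj₂ f) p = ∈-tabulate⁺ (∈-tabulate⁻ p)

  copies⊆E* : ∀ a {i} → i ∈ E a → copies i ⊆ E* a
  copies⊆E* a i∈E p = ∈-E*⁺ a (subst (_∈ E a) (sym (∈-copies⁻ p)) i∈E)

  star⊆E* : ∀ a {L} → L ⊆ E a → star L ⊆ E* a
  star⊆E* a L⊆E p = ∈-E*⁺ a (L⊆E (∈-star⁻ p))

  𝓛*⊆E* : ∀ a → All (λ (L , _) → L ⊆ E* a) (𝓛* a)
  𝓛*⊆E* a = All.++⁺
    (All.map⁺ {f = λ i → copies i , 1}
      (All.map (λ {i} i∈E {k} → copies⊆E* a {i} i∈E {k}) (All.all-filter (_∈? E a) (allFin n))))
    (All.map⁺ {f = map₁ star}
      (All.map (λ {(L , _)} L⊆E {k} → star⊆E* a {L} L⊆E {k}) (𝓛⊆E a)))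

  ∈-𝓛*⁻ : ∀ a {S} → S ∈ₗ map proj₁ (𝓛* a) →
          (∃ λ i → S ≡ copies i) ⊎ (∃ λ L → L ∈ₗ map proj₁ (𝓛 a) × S ≡ star L)
  ∈-𝓛*⁻ a p with _ , q , refl ← ∈-map⁻ proj₁ p
    with ∈-++⁻ (map (λ i → copies i , 1) (filter (_∈? E a) (allFin n))) q
  ... | inj₁ r with i , _ , refl ← ∈-map⁻ (λ i → copies i , 1) r = inj₁ (i , refl)
  ... | inj₂ r with (L , _) , L∈ , refl ← ∈-map⁻ (map₁ star) r =
    inj₂ (L , ∈-map⁺ proj₁ L∈ , refl)

  𝓛*-laminar : ∀ a → Laminar (map proj₁ (𝓛* a))
  𝓛*-laminar a p q with ∈-𝓛*⁻ a p | ∈-𝓛*⁻ a q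
  ... | inj₁ (i , refl)     | inj₁ (j , refl)      = nested-copies i j
  ... | inj₁ (i , refl)     | inj₂ (L , _ , refl)  = nested-copies-star i L
  ... | inj₂ (L , _ , refl) | inj₁ (j , refl)      = nested-sym (nested-copies-star j L)
  ... | inj₂ (_ , r , refl) | inj₂ (_ , s , refl)  = nested-star (𝓛-laminar a r s)

  list*-unique : ∀ a → Unique (list* a)
  list*-unique (inj₁ w) = WorkerList.unique (P (inj₁ w)) (P-unique (inj₁ w))
  list*-unique (inj₂ f) = FirmList.unique (P (inj₂ f)) (P-unique (inj₂ f))

  list*-complete : ∀ a {k} → k ∈ₗ list* a ⇔ orig k ∈ₗ concat (P a)
  list*-complete (inj₁ w) = mk⇔ (WorkerList.sound (P (inj₁ w))) (WorkerList.complete (P (inj₁ w)))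
  list*-complete (inj₂ f) = mk⇔ (FirmList.sound (P (inj₂ f))) (FirmList.complete (P (inj₂ f)))

  instance* : SMTI-LC nW nF (n * 3)
  instance* = record
    { ∂W         = ∂W ∘ orig
    ; ∂F         = ∂F ∘ orig
    ; 𝓛          = 𝓛*
    ; 𝓛⊆E        = 𝓛*⊆E*
    ; 𝓛-laminar  = 𝓛*-laminar
    ; P          = P*
    ; P-nonempty = λ a → All.map⁺ (All.universal (λ _ ()) (list* a))
    ; P-unique   = λ a → subst Unique (sym (concat-map-[ list* a ])) (list*-unique a)
    ; P-complete = λ a {k} → mk⇔
        (λ p → ∈-E*⁺ a (Equivalence.to (P-complete a)
                 (Equivalence.to (list*-complete a) (subst (k ∈ₗ_) concat-[ a ] p))))
        (λ p → subst (k ∈ₗ_) (sym concat-[ a ])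
                 (Equivalence.from (list*-complete a) (Equivalence.from (P-complete a) (∈-E*⁻ a p))))
    }
    where
    concat-[_] : ∀ a → concat (P* a) ≡ list* a
    concat-[ a ] = concat-map-[ list* a ]

open Auxiliary public using () renaming (instance* to auxiliary)

{-# OPTIONS --safe #-}
-- Let N be a stable matching of I.  On each side of the market, pair elements
-- of N greedily with elements of M, preferring pairs that lie together in as
-- many sets of the laminar family as possible.  For every set L of the family,
-- the pairs inside L exhaust L ∩ N or L ∩ M, so for each pair (e , g) both M + e - g and
-- N + g - e respect the quotas, and M + e does if e is unpaired.
--
-- If e is unpaired on the firm side, then its x-copy is free for the firm, hence
-- not for the worker; so M* contains an x- or y-copy of the worker-side partner
-- g of e, and the worker strictly prefers g to e when it is the y-copy.
-- Symmetrically, the firm-side partner of an element unpaired on the worker side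
-- is in M* as a z- or y-copy.  A common partner of both kinds would be a y-copy
-- and block N.  Hence the numbers u, v of unpaired elements on the two sides
-- satisfy u + v ≤ |M|, while |N| ≤ |M| + u and |N| ≤ |M| + v.

module Submission where

open import Defs
open import Data.Nat using (ℕ; _*_; _≤_)
open import Data.Product using (_×_)
open import Data.Fin.Subset using (Subset; ∣_∣)

open import Data.Empty using (⊥; ⊥-elim)
open import Data.Fin.Base using (Fin; zero; suc)
open import Data.Fin.Patterns using (0F; 1F; 2F)
import Data.Fin.Properties as Fin
open import Data.Fin.Subset
  using (_∈_; _∉_; _⊆_; _∩_; _∪_; _-_; ⁅_⁆; Nonempty; Empty; inside; outside)
open import Data.Fin.Subset.Properties
open import Data.List.Base
  using (List; []; _∷_; [_]; _++_; map; concat; concatMap; filter; length; allFin; cartesianProduct)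
open import Data.List.Extrema.Nat using (argmax; argmax-all; f[xs]≤f[argmax])
open import Data.List.Membership.Propositional using () renaming (_∈_ to _∈ₗ_)
open import Data.List.Membership.Propositional.Properties
  using (∈-map⁺; ∈-map⁻; ∈-++⁺ˡ; ∈-++⁺ʳ; ∈-++⁻; ∈-filter⁺; ∈-allFin; ∈-cartesianProduct⁺
        ; ∈-concatMap⁺; ∈-concatMap⁻)
open import Data.List.Properties using (concat-map-[_]; filter-≐)
open import Data.List.Relation.Unary.All using (All)
import Data.List.Relation.Unary.All as All
import Data.List.Relation.Unary.All.Properties as All
open import Data.List.Relation.Unary.Any using (here; there)
import Data.List.Relation.Unary.Any as Any
open import Data.Nat.Base using (_+_; _<_; suc; z≤n; s≤s)
open import Data.Nat.Properties
  using ( ≤-refl; ≤-trans; ≤-reflexive; <-≤-trans; ≤-<-trans; <⇒≱; m≤n⇒m≤1+n; +-comm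
        ; +-suc; +-identityʳ; +-mono-≤; +-monoʳ-≤; +-monoˡ-≤; module ≤-Reasoning)
open import Data.Nat.Tactic.RingSolver using (solve-∀)
open import Data.Product.Base using (∃; ∃₂; _,_; proj₁; proj₂; swap; uncurry; map₁)
open import Data.Sum.Base using (_⊎_; inj₁; inj₂)
import Data.Sum.Base as Sum
open import Data.Vec.Base using ([]; _∷_; here; there; tabulate)
open import Function.Base using (_∘_; flip; id)
open import Function.Bundles using (Equivalence)
open import Relation.Binary.Core using (Rel)
open import Relation.Binary.Definitions using (Decidable)
open import Relation.Binary.PropositionalEquality using (_≡_; _≢_; refl; sym; trans; cong; subst)
open import Relation.Nullary using (¬_; does; yes; no; contradiction; _×-dec_; _⊎-dec_; ¬?)
open import Relation.Nullary.Decidable using (dec-true)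
open import Relation.Unary using (Pred) renaming (Decidable to Decidable₁)
open import Level using (0ℓ)

private variable
  m n : ℕ

-- Cardinalities of subsets

x∉p-x : ∀ {x : Fin n} (p : Subset n) → x ∉ p - x
x∉p-x {x = zero}  (_ ∷ _) ()
x∉p-x {x = suc x} (_ ∷ p) (there q) = x∉p-x p q

x∈p-y⁻ : ∀ {x y : Fin n} (p : Subset n) → x ∈ p - y → x ∈ p × x ≢ y
x∈p-y⁻ {y = y} p q = p─q⊆p p ⁅ y ⁆ q , λ { refl → x∉p-x p q }

∣p∪q∣≤∣p∣+∣q∣ : ∀ (p q : Subset n) → ∣ p ∪ q ∣ ≤ ∣ p ∣ + ∣ q ∣
∣p∪q∣≤∣p∣+∣q∣ []            []            = z≤n
∣p∪q∣≤∣p∣+∣q∣ (outside ∷ p) (outside ∷ q) = ∣p∪q∣≤∣p∣+∣q∣ p q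
∣p∪q∣≤∣p∣+∣q∣ (outside ∷ p) (inside ∷ q)  =
  ≤-trans (s≤s (∣p∪q∣≤∣p∣+∣q∣ p q)) (≤-reflexive (sym (+-suc ∣ p ∣ ∣ q ∣)))
∣p∪q∣≤∣p∣+∣q∣ (inside ∷ p)  (outside ∷ q) = s≤s (∣p∪q∣≤∣p∣+∣q∣ p q)
∣p∪q∣≤∣p∣+∣q∣ (inside ∷ p)  (inside ∷ q)  =
  s≤s (≤-trans (∣p∪q∣≤∣p∣+∣q∣ p q) (+-monoʳ-≤ ∣ p ∣ (m≤n⇒m≤1+n ≤-refl)))

disjoint⇒∣p∣+∣q∣≤∣p∪q∣ : ∀ (p q : Subset n) → Empty (p ∩ q) → ∣ p ∣ + ∣ q ∣ ≤ ∣ p ∪ q ∣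
disjoint⇒∣p∣+∣q∣≤∣p∪q∣ []            []            _ = z≤n
disjoint⇒∣p∣+∣q∣≤∣p∪q∣ (outside ∷ p) (outside ∷ q) d = disjoint⇒∣p∣+∣q∣≤∣p∪q∣ p q (drop-∷-Empty d)
disjoint⇒∣p∣+∣q∣≤∣p∪q∣ (outside ∷ p) (inside ∷ q)  d =
  ≤-trans (≤-reflexive (+-suc ∣ p ∣ ∣ q ∣)) (s≤s (disjoint⇒∣p∣+∣q∣≤∣p∪q∣ p q (drop-∷-Empty d)))
disjoint⇒∣p∣+∣q∣≤∣p∪q∣ (inside ∷ p)  (outside ∷ q) d = s≤s (disjoint⇒∣p∣+∣q∣≤∣p∪q∣ p q (drop-∷-Empty d))
disjoint⇒∣p∣+∣q∣≤∣p∪q∣ (inside ∷ p)  (inside ∷ q)  d = ⊥-elim (d (zero , here))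

-- Once the head of `p` is sent to `j₀`, injectivity keeps the other elements away from `j₀`, so
-- they fit into `q - j₀`. With a relation in place of a function, a pairing can be used in either
-- direction.
injective⇒∣p∣≤∣q∣ : ∀ (R : Fin m → Fin n → Set) (p : Subset m) (q : Subset n) →
                    (∀ {i} → i ∈ p → ∃ λ j → j ∈ q × R i j) →
                    (∀ {i i′ j} → R i j → R i′ j → i ≡ i′) →
                    ∣ p ∣ ≤ ∣ q ∣
injective⇒∣p∣≤∣q∣ R []            q f inj = z≤n
injective⇒∣p∣≤∣q∣ R (outside ∷ p) q f inj =
  injective⇒∣p∣≤∣q∣ (R ∘ suc) p q (f ∘ there) (λ r s → Fin.suc-injective (inj r s))
injective⇒∣p∣≤∣q∣ R (inside ∷ p)  q f inj with j₀ , j₀∈q , r₀ ← f here =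
  ≤-<-trans
    (injective⇒∣p∣≤∣q∣ (R ∘ suc) p (q - j₀)
      (λ i∈p → let j , j∈q , r = f (there i∈p) in
        j , x∈p∧x≢y⇒x∈p-y j∈q (λ { refl → Fin.0≢1+n (inj r₀ r) }) , r)
      (λ r s → Fin.suc-injective (inj r s)))
    (x∈p⇒∣p-x∣<∣p∣ j₀∈q)

∣p∣≤1⇒x≡y : ∀ {p : Subset n} → ∣ p ∣ ≤ 1 → ∀ {x y} → x ∈ p → y ∈ p → x ≡ y
∣p∣≤1⇒x≡y {p = p} le {x} {y} x∈p y∈p with x Fin.≟ y
... | yes x≡y = x≡y
... | no  x≢y = contradiction le (<⇒≱ (≤-<-trans
  (≤-trans (≤-reflexive (sym (∣⁅x⁆∣≡1 y)))
    (p⊆q⇒∣p∣≤∣q∣ λ z∈ → subst (_∈ p - x) (sym (x∈⁅y⁆⇒x≡y y z∈)) (x∈p∧x≢y⇒x∈p-y y∈p (x≢y ∘ sym))))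
  (x∈p⇒∣p-x∣<∣p∣ x∈p)))

select : ∀ {P : Pred (Fin n) 0ℓ} → Decidable₁ P → Subset n
select P? = tabulate (λ i → does (P? i))

∈-select⁺ : ∀ {P : Pred (Fin n) 0ℓ} (P? : Decidable₁ P) {i} → P i → i ∈ select P?
∈-select⁺ P? {i} Pi = ∈-tabulate⁺ (dec-true (P? i) Pi)

∈-select⁻ : ∀ {P : Pred (Fin n) 0ℓ} (P? : Decidable₁ P) {i} → i ∈ select P? → P i
∈-select⁻ P? {i} i∈ with P? i | ∈-tabulate⁻ {f = λ i → does (P? i)} i∈
... | yes Pi | _ = Pi

-- Greedy pairings

module _ {A : Set} {P Q : Pred A 0ℓ} (P? : Decidable₁ P) (Q? : Decidable₁ Q) where

  length-filter-mono : ∀ xs → (∀ {x} → x ∈ₗ xs → P x → Q x) →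
                       length (filter P? xs) ≤ length (filter Q? xs)
  length-filter-mono []       P⇒Q = z≤n
  length-filter-mono (x ∷ xs) P⇒Q with ih ← length-filter-mono xs (P⇒Q ∘ there) | P? x | Q? x
  ... | yes p | yes q = s≤s ih
  ... | yes p | no ¬q = contradiction (P⇒Q (here refl) p) ¬q
  ... | no ¬p | yes q = m≤n⇒m≤1+n ih
  ... | no ¬p | no ¬q = ih

  length-filter-mono-< : ∀ xs {y} → (∀ {x} → x ∈ₗ xs → P x → Q x) → y ∈ₗ xs → ¬ P y → Q y →
                         length (filter P? xs) < length (filter Q? xs)
  length-filter-mono-< (x ∷ xs) P⇒Q (here refl) ¬p q with P? x | Q? x
  ... | yes p | _     = contradiction p ¬p
  ... | no _  | yes _ = s≤s (length-filter-mono xs (P⇒Q ∘ there))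
  ... | no _  | no ¬q = contradiction q ¬q
  length-filter-mono-< (x ∷ xs) P⇒Q (there y∈) ¬py qy
    with ih ← length-filter-mono-< xs (P⇒Q ∘ there) y∈ ¬py qy | P? x | Q? x
  ... | yes p | yes q = s≤s ih
  ... | yes p | no ¬q = contradiction (P⇒Q (here refl) p) ¬q
  ... | no ¬p | yes q = m≤n⇒m≤1+n ih
  ... | no ¬p | no ¬q = ih

record Pairing (A B : Subset n) : Set₁ where
  field
    _~_        : Rel (Fin n) 0ℓ
    _~?_       : Decidable _~_
    ~⇒∈        : ∀ {a b} → a ~ b → a ∈ A × b ∈ B
    functional : ∀ {a b b′} → a ~ b → a ~ b′ → b ≡ b′
    injective  : ∀ {a a′ b} → a ~ b → a′ ~ b → a ≡ a′

  Paired : Pred (Fin n) 0ℓ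
  Paired a = ∃ λ b → a ~ b

  paired? : Decidable₁ Paired
  paired? a = Fin.any? (a ~?_)

-- Equivalently, a stable marriage when both partners rank each other by c.
Greedy : ∀ {A B : Subset n} → (Fin n → Fin n → ℕ) → Pairing A B → Set
Greedy {A = A} {B} c p = ∀ {a b} → a ∈ A → b ∈ B →
    (∃ λ b′ → a ~ b′ × c a b ≤ c a b′) ⊎ (∃ λ a′ → a′ ~ b × c a b ≤ c a′ b)
  where open Pairing p

transpose : ∀ {A B : Subset n} → Pairing A B → Pairing B A
transpose p = record
  { _~_        = flip _~_
  ; _~?_       = flip _~?_
  ; ~⇒∈        = swap ∘ ~⇒∈
  ; functional = injective
  ; injective  = functional
  } where open Pairing p

maximalPair : ∀ (c : Fin n → Fin n → ℕ) {A B : Subset n} → Nonempty A → Nonempty B →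
              ∃₂ λ a b → (a ∈ A × b ∈ B) × (∀ {a′ b′} → a′ ∈ A → b′ ∈ B → c a′ b′ ≤ c a b)
maximalPair {n} c {A} {B} (a₀ , a₀∈A) (b₀ , b₀∈B) =
  proj₁ best , proj₂ best ,
  -- The default of `argmax` must itself lie in `A × B`, since `best` may equal it.
  argmax-all (uncurry c) (a₀∈A , b₀∈B) (All.all-filter inBoth? all) ,
  λ a∈A b∈B → All.lookup (f[xs]≤f[argmax] {f = uncurry c} (a₀ , b₀) (filter inBoth? all))
    (∈-filter⁺ inBoth? (∈-cartesianProduct⁺ (∈-allFin _) (∈-allFin _)) (a∈A , b∈B))
  where
  inBoth? : Decidable₁ (λ (a , b) → a ∈ A × b ∈ B)
  inBoth? (a , b) = a ∈? A ×-dec b ∈? B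
  all = cartesianProduct (allFin n) (allFin n)
  best = argmax (uncurry c) (a₀ , b₀) (filter inBoth? all)

-- Take a pair of maximal value, delete both ends and recurse: pairs sharing an end with it have no
-- larger value, and all others survive the deletion.
greedyPairing : ∀ (c : Fin n → Fin n → ℕ) (A B : Subset n) → ∃ λ (p : Pairing A B) → Greedy c p
greedyPairing {n} c A B = go ∣ A ∣ A B ≤-refl
  where
  empty : ∀ {A B : Subset n} → Pairing A B
  empty = record
    { _~_        = λ _ _ → ⊥
    ; _~?_       = λ _ _ → no id
    ; ~⇒∈        = ⊥-elim
    ; functional = λ ()
    ; injective  = λ ()
    }

  extend : ∀ {A B : Subset n} {a b} → a ∈ A → b ∈ B → Pairing (A - a) (B - b) → Pairing A B
  extend {A} {B} {a} {b} a∈A b∈B p = record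
    { _~_        = λ x y → (x ≡ a × y ≡ b) ⊎ x ~ y
    ; _~?_       = λ x y → (x Fin.≟ a ×-dec y Fin.≟ b) ⊎-dec (x ~? y)
    ; ~⇒∈        = λ where
        (inj₁ (refl , refl)) → a∈A , b∈B
        (inj₂ r) → p─q⊆p A ⁅ a ⁆ (proj₁ (~⇒∈ r)) , p─q⊆p B ⁅ b ⁆ (proj₂ (~⇒∈ r))
    ; functional = λ where
        (inj₁ (_ , refl)) (inj₁ (_ , refl)) → refl
        (inj₁ (refl , _)) (inj₂ r) → ⊥-elim (x∉p-x A (proj₁ (~⇒∈ r)))
        (inj₂ r) (inj₁ (refl , _)) → ⊥-elim (x∉p-x A (proj₁ (~⇒∈ r)))
        (inj₂ r) (inj₂ s) → functional r s
    ; injective  = λ where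
        (inj₁ (refl , _)) (inj₁ (refl , _)) → refl
        (inj₁ (_ , refl)) (inj₂ r) → ⊥-elim (x∉p-x B (proj₂ (~⇒∈ r)))
        (inj₂ r) (inj₁ (_ , refl)) → ⊥-elim (x∉p-x B (proj₂ (~⇒∈ r)))
        (inj₂ r) (inj₂ s) → injective r s
    } where open Pairing p

  go : ∀ d (A B : Subset n) → ∣ A ∣ ≤ d → ∃ λ (p : Pairing A B) → Greedy c p
  go d A B le with nonempty? A | nonempty? B
  ... | no A≡∅ | _ = empty , λ a∈A _ → ⊥-elim (A≡∅ (_ , a∈A))
  ... | _ | no B≡∅ = empty , λ _ b∈B → ⊥-elim (B≡∅ (_ , b∈B))
  ... | yes A≢∅ | yes B≢∅ with a , b , (a∈A , b∈B) , max ← maximalPair c A≢∅ B≢∅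
    -- `d` is fuel bounding `∣ A ∣`; deleting `a` lowers the size strictly, which rules out `d = 0`.
    with d | <-≤-trans (x∈p⇒∣p-x∣<∣p∣ a∈A) le
  ...   | suc d | s≤s le′ with p , greedy ← go d (A - a) (B - b) le′ =
    extend a∈A b∈B p , greedy′
    where
    greedy′ : Greedy c (extend a∈A b∈B p)
    greedy′ {a′} {b′} a′∈A b′∈B with a′ Fin.≟ a | b′ Fin.≟ b
    ... | yes refl | _ = inj₁ (b , inj₁ (refl , refl) , max a′∈A b′∈B)
    ... | no _ | yes refl = inj₂ (a , inj₁ (refl , refl) , max a′∈A b′∈B)
    ... | no a′≢a | no b′≢b = Sum.map
      (λ (y , r , le) → y , inj₂ r , le) (λ (x , r , le) → x , inj₂ r , le)
      (greedy (x∈p∧x≢y⇒x∈p-y a′∈A a′≢a) (x∈p∧x≢y⇒x∈p-y b′∈B b′≢b))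

-- Pairings adapted to a laminar family

-- For each `L`, the pairs inside `L` form a maximal matching of the complete bipartite graph
-- between `A ∩ L` and `B ∩ L`, and so exhaust one of the two.
LocallyMaximal : ∀ {A B : Subset n} → List (Subset n) → Pairing A B → Set
LocallyMaximal {A = A} {B} F p = ∀ {L a b} → L ∈ₗ F → a ∈ A → a ∈ L → b ∈ B → b ∈ L →
    (∃ λ b′ → a ~ b′ × b′ ∈ L) ⊎ (∃ λ a′ → a′ ~ b × a′ ∈ L)
  where open Pairing p

module _ (F : List (Subset n)) where

  -- In the forest of a laminar family, this is the depth of the smallest member containing both,
  -- repetitions counted.
  closeness : Fin n → Fin n → ℕ
  closeness a b = length (filter (λ S → a ∈? S ×-dec b ∈? S) F)

  closeness-comm : ∀ a b → closeness a b ≡ closeness b a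
  closeness-comm a b = cong length (filter-≐ (λ S → a ∈? S ×-dec b ∈? S)
    (λ S → b ∈? S ×-dec a ∈? S) (swap , swap) F)

  -- A member of F containing a and b′ ∉ L is not inside L, so contains L.
  closeness-leaving : Laminar F → ∀ {L a b b′} → L ∈ₗ F → a ∈ L → b ∈ L → b′ ∉ L →
                      closeness a b′ < closeness a b
  closeness-leaving lam {L} {a} {b} {b′} L∈F a∈L b∈L b′∉L =
    length-filter-mono-< (λ S → a ∈? S ×-dec b′ ∈? S) (λ S → a ∈? S ×-dec b ∈? S) F
      absorb L∈F (b′∉L ∘ proj₂) (a∈L , b∈L)
    where
    absorb : ∀ {S} → S ∈ₗ F → a ∈ S × b′ ∈ S → a ∈ S × b ∈ S
    absorb S∈F (a∈S , b′∈S) with lam S∈F L∈F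
    ... | inj₁ S⊆L        = contradiction (S⊆L b′∈S) b′∉L
    ... | inj₂ (inj₁ L⊆S) = a∈S , L⊆S b∈L
    ... | inj₂ (inj₂ S∩L≡∅) = contradiction (_ , x∈p∩q⁺ (a∈S , a∈L)) S∩L≡∅

  closeness-staying : Laminar F → ∀ {L a b b′} → L ∈ₗ F → a ∈ L → b ∈ L →
                      closeness a b ≤ closeness a b′ → b′ ∈ L
  closeness-staying lam {L} {b′ = b′} L∈F a∈L b∈L le with b′ ∈? L
  ... | yes b′∈L = b′∈L
  ... | no  b′∉L = contradiction le (<⇒≱ (closeness-leaving lam L∈F a∈L b∈L b′∉L))

  -- A greedy partner is at least as close as the rival, so `closeness-staying` keeps it in `L`. The
  -- second case measures from `b`, hence the use of symmetry.
  greedy⇒locallyMaximal : Laminar F → ∀ {A B} (p : Pairing A B) → Greedy closeness p → LocallyMaximal F p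
  greedy⇒locallyMaximal lam p greedy {a = a} {b} L∈F a∈A a∈L b∈B b∈L = Sum.map
    (λ (b′ , r , le) → b′ , r , closeness-staying lam L∈F a∈L b∈L le)
    (λ (a′ , r , le) → a′ , r , closeness-staying lam L∈F b∈L a∈L
      (subst (_≤ closeness b a′) (closeness-comm a b) (≤-trans le (≤-reflexive (closeness-comm a′ b)))))
    (greedy a∈A b∈B)

transpose-locallyMaximal : ∀ {F} {A B : Subset n} (p : Pairing A B) →
                           LocallyMaximal F p → LocallyMaximal F (transpose p)
transpose-locallyMaximal p lm L∈F b∈B b∈L a∈A a∈L = Sum.swap (lm L∈F a∈A a∈L b∈B b∈L)

module Exchange {F : List (Subset n)} {A B : Subset n} (p : Pairing A B) (lm : LocallyMaximal F p) where
  open Pairing p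

  -- Since `a` has no partner in `L`, local maximality gives every `b` in `B ∩ L` a partner in `L`,
  -- and that partner is not `a`. So `B ∩ L` injects into `(A ∩ L) - a`.
  partner-outside : ∀ {L a} → L ∈ₗ F → a ∈ A → a ∈ L → (∀ {b} → a ~ b → b ∉ L) → ∣ B ∩ L ∣ < ∣ A ∩ L ∣
  partner-outside {L} {a} L∈F a∈A a∈L out = ≤-<-trans
    (injective⇒∣p∣≤∣q∣ (flip _~_) (B ∩ L) ((A ∩ L) - a) inward functional)
    (x∈p⇒∣p-x∣<∣p∣ (x∈p∩q⁺ (a∈A , a∈L)))
    where
    inward : ∀ {b} → b ∈ B ∩ L → ∃ λ a′ → a′ ∈ (A ∩ L) - a × a′ ~ b
    inward b∈ with b∈B , b∈L ← x∈p∩q⁻ B L b∈ with lm L∈F a∈A a∈L b∈B b∈L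
    ... | inj₁ (_ , r , b′∈L) = contradiction b′∈L (out r)
    ... | inj₂ (a′ , r , a′∈L) =
      a′ , x∈p∧x≢y⇒x∈p-y (x∈p∩q⁺ (proj₁ (~⇒∈ r) , a′∈L)) (λ { refl → out r b∈L }) , r

  -- If `a` is in `L`, the strict inequality of `partner-outside` leaves room for one more element
  -- below the quota that `A` respects; otherwise `L` sees no change.
  augment : ∀ {L a q} → L ∈ₗ F → ∣ A ∩ L ∣ ≤ q → ∣ B ∩ L ∣ ≤ q → a ∈ A → (∀ {b} → a ~ b → b ∉ L) →
            ∣ (B ∪ ⁅ a ⁆) ∩ L ∣ ≤ q
  augment {L} {a} {q} L∈F A≤ B≤ a∈A out with a ∈? L
  ... | no a∉L = ≤-trans (p⊆q⇒∣p∣≤∣q∣ shrink) B≤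
    where
    shrink : (B ∪ ⁅ a ⁆) ∩ L ⊆ B ∩ L
    shrink i∈ with i∈∪ , i∈L ← x∈p∩q⁻ (B ∪ ⁅ a ⁆) L i∈ with x∈p∪q⁻ B ⁅ a ⁆ i∈∪
    ... | inj₁ i∈B = x∈p∩q⁺ (i∈B , i∈L)
    ... | inj₂ i∈a = contradiction (subst (_∈ L) (x∈⁅y⁆⇒x≡y a i∈a) i∈L) a∉L
  ... | yes a∈L = begin
    ∣ (B ∪ ⁅ a ⁆) ∩ L ∣     ≤⟨ p⊆q⇒∣p∣≤∣q∣ split ⟩
    ∣ ⁅ a ⁆ ∪ (B ∩ L) ∣     ≤⟨ ∣p∪q∣≤∣p∣+∣q∣ ⁅ a ⁆ (B ∩ L) ⟩
    ∣ ⁅ a ⁆ ∣ + ∣ B ∩ L ∣   ≡⟨ cong (_+ ∣ B ∩ L ∣) (∣⁅x⁆∣≡1 a) ⟩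
    1 + ∣ B ∩ L ∣           ≤⟨ partner-outside L∈F a∈A a∈L out ⟩
    ∣ A ∩ L ∣               ≤⟨ A≤ ⟩
    q                       ∎
    where
    open ≤-Reasoning
    split : (B ∪ ⁅ a ⁆) ∩ L ⊆ ⁅ a ⁆ ∪ (B ∩ L)
    split i∈ with i∈∪ , i∈L ← x∈p∩q⁻ (B ∪ ⁅ a ⁆) L i∈ with x∈p∪q⁻ B ⁅ a ⁆ i∈∪
    ... | inj₁ i∈B = x∈p∪q⁺ (inj₂ (x∈p∩q⁺ (i∈B , i∈L)))
    ... | inj₂ i∈a = x∈p∪q⁺ (inj₁ i∈a)

  -- If `b` is in `L`, its removal pays for `a`. If not, the only partner of `a` is outside `L`, and
  -- `augment` applies.
  exchange : ∀ {L a b q} → L ∈ₗ F → ∣ A ∩ L ∣ ≤ q → ∣ B ∩ L ∣ ≤ q → a ~ b →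
             ∣ ((B ∪ ⁅ a ⁆) - b) ∩ L ∣ ≤ q
  exchange {L} {a} {b} {q} L∈F A≤ B≤ r with b ∈? L
  ... | no b∉L = ≤-trans (p⊆q⇒∣p∣≤∣q∣ widen)
      (augment L∈F A≤ B≤ (proj₁ (~⇒∈ r)) (λ s → subst (_∉ L) (functional r s) b∉L))
    where
    widen : ((B ∪ ⁅ a ⁆) - b) ∩ L ⊆ (B ∪ ⁅ a ⁆) ∩ L
    widen i∈ with i∈- , i∈L ← x∈p∩q⁻ ((B ∪ ⁅ a ⁆) - b) L i∈ =
      x∈p∩q⁺ (p─q⊆p (B ∪ ⁅ a ⁆) ⁅ b ⁆ i∈- , i∈L)
  ... | yes b∈L = begin
    ∣ ((B ∪ ⁅ a ⁆) - b) ∩ L ∣     ≤⟨ p⊆q⇒∣p∣≤∣q∣ split ⟩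
    ∣ ⁅ a ⁆ ∪ ((B ∩ L) - b) ∣     ≤⟨ ∣p∪q∣≤∣p∣+∣q∣ ⁅ a ⁆ ((B ∩ L) - b) ⟩
    ∣ ⁅ a ⁆ ∣ + ∣ (B ∩ L) - b ∣   ≡⟨ cong (_+ ∣ (B ∩ L) - b ∣) (∣⁅x⁆∣≡1 a) ⟩
    1 + ∣ (B ∩ L) - b ∣           ≤⟨ x∈p⇒∣p-x∣<∣p∣ (x∈p∩q⁺ (proj₂ (~⇒∈ r) , b∈L)) ⟩
    ∣ B ∩ L ∣                     ≤⟨ B≤ ⟩
    q                             ∎
    where
    open ≤-Reasoning
    split : ((B ∪ ⁅ a ⁆) - b) ∩ L ⊆ ⁅ a ⁆ ∪ ((B ∩ L) - b)
    split i∈ with i∈- , i∈L ← x∈p∩q⁻ ((B ∪ ⁅ a ⁆) - b) L i∈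
      with i∈∪ , i≢b ← x∈p-y⁻ (B ∪ ⁅ a ⁆) i∈- with x∈p∪q⁻ B ⁅ a ⁆ i∈∪
    ... | inj₁ i∈B = x∈p∪q⁺ (inj₂ (x∈p∧x≢y⇒x∈p-y (x∈p∩q⁺ (i∈B , i∈L)) i≢b))
    ... | inj₂ i∈a = x∈p∪q⁺ (inj₁ i∈a)

-- Preferences of the auxiliary instance

≻-++ : ∀ {us vs : List (Fin n)} {k k′} → k ∈ₗ us → k′ ∈ₗ vs → map [_] (us ++ vs) ⊢ k ≻ k′
≻-++ {us = u ∷ us} {vs} (here refl) k′∈ =
  here (here refl) (subst (_ ∈ₗ_) (sym (concat-map-[ us ++ vs ])) (∈-++⁺ʳ us k′∈))
≻-++ {us = u ∷ us} (there k∈)  k′∈ = there (≻-++ k∈ k′∈)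

≻-++ˡ : ∀ {us vs : List (Fin n)} {k k′} → map [_] us ⊢ k ≻ k′ → map [_] (us ++ vs) ⊢ k ≻ k′
≻-++ˡ {us = u ∷ us} {vs} (here k≡u k′∈) = here k≡u (subst (_ ∈ₗ_) (sym (concat-map-[ us ++ vs ]))
  (∈-++⁺ˡ (subst (_ ∈ₗ_) (concat-map-[ us ]) k′∈)))
≻-++ˡ {us = u ∷ us} (there r) = there (≻-++ˡ r)

≻-++ʳ : ∀ (us : List (Fin n)) {vs k k′} → map [_] vs ⊢ k ≻ k′ → map [_] (us ++ vs) ⊢ k ≻ k′
≻-++ʳ []       r = r
≻-++ʳ (u ∷ us) r = there (≻-++ʳ us r)

≻⇒∈ : ∀ {Ts : PrefList n} {e e′} → Ts ⊢ e ≻ e′ → e ∈ₗ concat Ts × e′ ∈ₗ concat Ts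
≻⇒∈ {Ts = T ∷ Ts} (here e∈ e′∈) = ∈-++⁺ˡ e∈ , ∈-++⁺ʳ T e′∈
≻⇒∈ {Ts = T ∷ Ts} (there r) with e∈ , e′∈ ← ≻⇒∈ r = ∈-++⁺ʳ T e∈ , ∈-++⁺ʳ T e′∈

module StrictifyOrder (n : ℕ) (c d : Fin 3) (c≢1 : c ≢ 1F) (d≢c : d ≢ c) (d≢1 : d ≢ 1F)
                      (cover : ∀ b → b ≡ c ⊎ b ≡ 1F ⊎ b ≡ d) where
  open Copies n
  open Strictify c d c≢1 d≢c d≢1 cover

  _⊢*_≻_ : PrefList n → Fin (n * 3) → Fin (n * 3) → Set
  Ts ⊢* k ≻ k′ = map [_] (strictify (copy c) (copy d) Ts) ⊢ k ≻ k′

  y≻copy-block : ∀ {Ts e e′ b} → b ≡ c ⊎ b ≡ 1F → Ts ⊢ e ≻ e′ →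
                 map [_] (concatMap block Ts) ⊢ y e ≻ copy b e′
  y≻copy-block {T ∷ Ts} {b = b} b≡ (here e∈ e′∈) =
    ≻-++ (∈-++⁺ʳ (map (copy c) T) (∈-map⁺ y e∈)) (blocks-∋ Ts b b≡ e′∈)
  y≻copy-block {T ∷ Ts} b≡ (there r) = ≻-++ʳ (block T) (y≻copy-block b≡ r)

  -- Copies of `e′` of kind `c` or `1F` stand in a later block than `y e`; the copy of kind `d`
  -- stands in the tail, after all blocks.
  y≻copy : ∀ {Ts e e′} b → Ts ⊢ e ≻ e′ → Ts ⊢* y e ≻ copy b e′
  y≻copy {Ts} b r with cover b
  ... | inj₁ b≡c         = ≻-++ˡ (y≻copy-block (inj₁ b≡c) r)
  ... | inj₂ (inj₁ b≡1)  = ≻-++ˡ (y≻copy-block (inj₂ b≡1) r)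
  ... | inj₂ (inj₂ refl) =
    ≻-++ (blocks-∋ Ts 1F (inj₂ refl) (proj₁ (≻⇒∈ r))) (∈-map⁺ (copy d) (proj₂ (≻⇒∈ r)))

  first≻last : ∀ {Ts e e′} → e ∈ₗ concat Ts → e′ ∈ₗ concat Ts → Ts ⊢* copy c e ≻ copy d e′
  first≻last {Ts} e∈ e′∈ = ≻-++ (blocks-∋ Ts c (inj₁ refl) e∈) (∈-map⁺ (copy d) e′∈)

  -- Within one tie all copies of kind `c` precede all y-copies, whatever the written order. Only an
  -- `e′` from an earlier tie could come first, which the hypothesis excludes.
  first≻y : ∀ {Ts e e′} → e ∈ₗ concat Ts → e′ ∈ₗ concat Ts → ¬ (Ts ⊢ e′ ≻ e) → Ts ⊢* copy c e ≻ y e′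
  first≻y {Ts} {e} {e′} e∈ e′∈ ¬r = ≻-++ˡ (in-blocks Ts e∈ e′∈ ¬r)
    where
    in-blocks : ∀ Ts → e ∈ₗ concat Ts → e′ ∈ₗ concat Ts → ¬ (Ts ⊢ e′ ≻ e) →
                map [_] (concatMap block Ts) ⊢ copy c e ≻ y e′
    in-blocks (T ∷ Ts) e∈ e′∈ ¬r with ∈-++⁻ T e∈ | ∈-++⁻ T e′∈
    ... | inj₁ p | inj₁ q = ≻-++ˡ (≻-++ (∈-map⁺ (copy c) p) (∈-map⁺ y q))
    ... | inj₁ p | inj₂ q = ≻-++ (∈-++⁺ˡ (∈-map⁺ (copy c) p)) (blocks-∋ Ts 1F (inj₂ refl) q)
    ... | inj₂ p | inj₁ q = contradiction (here q p) ¬r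
    ... | inj₂ p | inj₂ q = ≻-++ʳ (block T) (in-blocks Ts p q (¬r ∘ there))

module WorkerOrder (n : ℕ) = StrictifyOrder n 0F 2F (λ ()) (λ ()) (λ ()) cover-worker
module FirmOrder (n : ℕ) = StrictifyOrder n 2F 0F (λ ()) (λ ()) (λ ()) cover-firm

-- Transfer between an instance and its auxiliary instance

module Transfer {nW nF n : ℕ} (I : SMTI-LC nW nF n) where
  open SMTI-LC I
  open Copies n
  open Auxiliary I using (E*; ∈-E*⁺; ∈-E*⁻; P*)
  module I* = SMTI-LC (auxiliary I)

  ∈E-∂W : ∀ e → e ∈ E (inj₁ (∂W e))
  ∈E-∂W e = ∈-select⁺ (λ i → ∂W i Fin.≟ ∂W e) refl

  ∈E-∂F : ∀ e → e ∈ E (inj₂ (∂F e))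
  ∈E-∂F e = ∈-select⁺ (λ i → ∂F i Fin.≟ ∂F e) refl

  quota⇒feasible : ∀ a S → (∀ {L q} → (L , q) ∈ₗ 𝓛 a → ∣ S ∩ L ∣ ≤ q) → Feasible a S
  quota⇒feasible a S h = All.tabulate λ {(L , q)} L∈ → ≤-trans
    (p⊆q⇒∣p∣≤∣q∣ λ i∈ → let i∈SE , i∈L = x∈p∩q⁻ (S ∩ E a) L i∈ in
      x∈p∩q⁺ (p∩q⊆p S (E a) i∈SE , i∈L))
    (h L∈)

  feasible⇒quota : ∀ a S → Feasible a S → ∀ {L q} → (L , q) ∈ₗ 𝓛 a → ∣ S ∩ L ∣ ≤ q
  feasible⇒quota a S feas {L} L∈ = ≤-trans
    (p⊆q⇒∣p∣≤∣q∣ λ i∈ → let i∈S , i∈L = x∈p∩q⁻ S L i∈ in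
      x∈p∩q⁺ (x∈p∩q⁺ (i∈S , All.lookup (𝓛⊆E a) L∈ i∈L) , i∈L))
    (All.lookup feas L∈)

  feasible-⊆ : ∀ a {S T} → S ⊆ T → Feasible a T → Feasible a S
  feasible-⊆ a {S} {T} S⊆T feas = quota⇒feasible a S λ {L} L∈ → ≤-trans
    (p⊆q⇒∣p∣≤∣q∣ λ i∈ → let i∈S , i∈L = x∈p∩q⁻ S L i∈ in x∈p∩q⁺ (S⊆T i∈S , i∈L))
    (feasible⇒quota a T feas L∈)

  -- The kind of copy opening each block of an agent's list, and the kind appended at its end. Each
  -- kind that is last on one side is first on the other, so only y-copies are last on neither.
  first last : Agent → Fin 3
  first (inj₁ _) = 0F
  first (inj₂ _) = 2F
  last (inj₁ _) = 2F
  last (inj₂ _) = 0F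

  ∈-P : ∀ {a e} → e ∈ E a → e ∈ₗ concat (P a)
  ∈-P {a} = Equivalence.from (P-complete a)

  y-outranks : ∀ a {e e′} b → P a ⊢ e ≻ e′ → P* a ⊢ y e ≻ copy b e′
  y-outranks (inj₁ w) = WorkerOrder.y≻copy n
  y-outranks (inj₂ f) = FirmOrder.y≻copy n

  first-outranks-last : ∀ a {e e′} → e ∈ E a → e′ ∈ E a → P* a ⊢ copy (first a) e ≻ copy (last a) e′
  first-outranks-last (inj₁ w) p q = WorkerOrder.first≻last n {P (inj₁ w)} (∈-P p) (∈-P q)
  first-outranks-last (inj₂ f) p q = FirmOrder.first≻last n {P (inj₂ f)} (∈-P p) (∈-P q)

  first-outranks-y : ∀ a {e e′} → e ∈ E a → e′ ∈ E a → ¬ (P a ⊢ e′ ≻ e) → P* a ⊢ copy (first a) e ≻ y e′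
  first-outranks-y (inj₁ w) p q = WorkerOrder.first≻y n {P (inj₁ w)} (∈-P p) (∈-P q)
  first-outranks-y (inj₂ f) p q = FirmOrder.first≻y n {P (inj₂ f)} (∈-P p) (∈-P q)

  -- With at most one copy per contract, `orig` is injective on `S`. The sets `copies i` are then
  -- bounded by `∣ ⁅ i ⁆ ∣ = 1`, and the sets `star L` by the quota that `T` obeys on `L`.
  lift-feasible : ∀ a {S : Subset (n * 3)} {T : Subset n} →
                  (∀ {k l} → k ∈ S → l ∈ S → orig k ≡ orig l → k ≡ l) →
                  (∀ {k} → k ∈ S → orig k ∈ T) →
                  Feasible a T → I*.Feasible a S
  lift-feasible a {S} {T} inj S⊆T feas = All.++⁺
    (All.map⁺ {f = λ i → copies i , 1} (All.universal
      (λ i → ≤-trans (bound ⁅ i ⁆ (λ p → subst (_∈ ⁅ i ⁆) (sym (∈-copies⁻ p)) (x∈⁅x⁆ i)))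
        (≤-trans (∣p∩q∣≤∣q∣ T ⁅ i ⁆) (≤-reflexive (∣⁅x⁆∣≡1 i)))) _))
    (All.map⁺ {f = map₁ star} (All.tabulate λ {(L , q)} L∈ →
      ≤-trans (bound L ∈-star⁻) (feasible⇒quota a T feas L∈)))
    where
    bound : ∀ {S′} (L : Subset n) → (∀ {k} → k ∈ S′ → orig k ∈ L) → ∣ (S ∩ E* a) ∩ S′ ∣ ≤ ∣ T ∩ L ∣
    bound {S′} L S′⊆L = injective⇒∣p∣≤∣q∣ (λ k i → k ∈ S × orig k ≡ i) _ _
      (λ {k} k∈ → let k∈SE , k∈S′ = x∈p∩q⁻ (S ∩ E* a) S′ k∈ ; k∈S = p∩q⊆p S (E* a) k∈SE in
        orig k , x∈p∩q⁺ (S⊆T k∈S , S′⊆L k∈S′) , k∈S , refl)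
      (λ (k∈S , p) (l∈S , q) → inj k∈S l∈S (trans p (sym q)))

  -- Stability of the projected matching

  module Matched (M* : Subset (n * 3)) (matching* : I*.Matching M*) where

    M : Subset n
    M = π M*

    ∈M⁻ : ∀ {i} → i ∈ M → ∃ λ b → copy b i ∈ M*
    ∈M⁻ {i} i∈M with k , k∈ ← ∈-select⁻ (λ i → nonempty? (copies i ∩ M*)) i∈M
      with k∈i , k∈M* ← x∈p∩q⁻ (copies i) M* k∈
      with refl ← ∈-copies⁻ k∈i
      with b , eq ← copy-orig k = b , subst (_∈ M*) (sym eq) k∈M*

    ∈M⁺ : ∀ {k} → k ∈ M* → orig k ∈ M
    ∈M⁺ k∈M* = ∈-select⁺ (λ i → nonempty? (copies i ∩ M*)) (_ , x∈p∩q⁺ (∈-copies⁺ refl , k∈M*))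

    -- This is the quota 1 on `copies i`, read off at the worker of the contract.
    one-copy : ∀ {k l} → k ∈ M* → l ∈ M* → orig k ≡ orig l → k ≡ l
    one-copy {k} {l} k∈ l∈ eq = ∣p∣≤1⇒x≡y (All.lookup (matching* a) copies∈) (member k∈ refl) (member l∈ (sym eq))
      where
      i = orig k
      a = inj₁ (∂W i)
      copies∈ : (copies i , 1) ∈ₗ I*.𝓛 a
      copies∈ = ∈-++⁺ˡ (∈-map⁺ (λ i → copies i , 1) (∈-filter⁺ (_∈? E a) (∈-allFin i) (∈E-∂W i)))
      member : ∀ {k} → k ∈ M* → orig k ≡ i → k ∈ (M* ∩ E* a) ∩ copies i
      member k∈ eq = x∈p∩q⁺ (x∈p∩q⁺ (k∈ , ∈-E*⁺ a (subst (_∈ E a) (sym eq) (∈E-∂W i))) , ∈-copies⁺ eq)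

    -- Each contract of `M ∩ L` has a copy in `M*` and in `star L`, distinct contracts have distinct
    -- copies, and `star L` carries the quota of `L`.
    matching : Matching M
    matching a = quota⇒feasible a M λ {L} {q} L∈ → ≤-trans
      (injective⇒∣p∣≤∣q∣ (λ i k → orig k ≡ i) (M ∩ L) ((M* ∩ E* a) ∩ star L)
        (λ {i} i∈ → let i∈M , i∈L = x∈p∩q⁻ M L i∈
                        b , k∈M* = ∈M⁻ i∈M
                        lift : ∀ {T} → i ∈ T → orig (copy b i) ∈ T
                        lift {T} = subst (_∈ T) (sym (orig-copy b i))
                    in copy b i
                     , x∈p∩q⁺ (x∈p∩q⁺ (k∈M* , ∈-E*⁺ a (lift (All.lookup (𝓛⊆E a) L∈ i∈L))) , ∈-star⁺ (lift i∈L))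
                     , orig-copy b i)
        (λ p q → trans (sym p) q))
      (All.lookup (matching* a) (∈-++⁺ʳ _ (∈-map⁺ (map₁ star) L∈)))

    copy∉M* : ∀ c {e} → e ∉ M → copy c e ∉ M*
    copy∉M* c {e} e∉M k∈ = e∉M (subst (_∈ M) (orig-copy c e) (∈M⁺ k∈))

    module _ {a : Agent} {e : Fin n} (c : Fin 3) (e∉M : e ∉ M) where

      private
        Mₐ* = M* ∩ E* a
        k = copy c e

        ∈-added : ∀ {l} → l ∈ Mₐ* ∪ ⁅ k ⁆ → (l ∈ M* × orig l ∈ M ∩ E a) ⊎ l ≡ k
        ∈-added l∈ with x∈p∪q⁻ Mₐ* ⁅ k ⁆ l∈
        ... | inj₂ l∈k = inj₂ (x∈⁅y⁆⇒x≡y k l∈k)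
        ... | inj₁ l∈M with l∈M* , l∈E ← x∈p∩q⁻ M* (E* a) l∈M =
          inj₁ (l∈M* , x∈p∩q⁺ (∈M⁺ l∈M* , ∈-E*⁻ a l∈E))

        absurd-orig : ∀ {l} → l ∈ M* → orig l ≢ orig k
        absurd-orig l∈ eq = e∉M (subst (_∈ M) (trans eq (orig-copy c e)) (∈M⁺ l∈))

        -- `M*` has no copy of `e`, because `e ∉ M`, so `k` meets no other copy of its contract.
        one-copy-added : ∀ {l l′} → l ∈ Mₐ* ∪ ⁅ k ⁆ → l′ ∈ Mₐ* ∪ ⁅ k ⁆ → orig l ≡ orig l′ → l ≡ l′
        one-copy-added l∈ l′∈ eq with ∈-added l∈ | ∈-added l′∈
        ... | inj₁ (p , _) | inj₁ (q , _) = one-copy p q eq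
        ... | inj₁ (p , _) | inj₂ refl    = contradiction eq (absurd-orig p)
        ... | inj₂ refl    | inj₁ (q , _) = contradiction (sym eq) (absurd-orig q)
        ... | inj₂ refl    | inj₂ refl    = refl

        orig-added : ∀ {l} → l ∈ Mₐ* ∪ ⁅ k ⁆ → orig l ∈ (M ∩ E a) ∪ ⁅ e ⁆
        orig-added l∈ with ∈-added l∈
        ... | inj₁ (_ , p) = x∈p∪q⁺ (inj₁ p)
        ... | inj₂ refl    = x∈p∪q⁺ (inj₂ (subst (_∈ ⁅ e ⁆) (sym (orig-copy c e)) (x∈⁅x⁆ e)))

      free-add : Feasible a ((M ∩ E a) ∪ ⁅ e ⁆) → I*.Free M* k a
      free-add feas = inj₁ (lift-feasible a one-copy-added orig-added feas)

      -- `h` is the only copy of `g` present, so removing it removes `g` from the projection and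
      -- feasibility lifts.
      free-exchange : ∀ {g b} → g ∈ E a → copy b g ∈ M* → P* a ⊢ k ≻ copy b g →
                      Feasible a (((M ∩ E a) ∪ ⁅ e ⁆) - g) → I*.Free M* k a
      free-exchange {g} {b} g∈E h∈M* k≻h feas = inj₂
        (h , x∈p∩q⁺ (h∈M* , ∈-E*⁺ a (subst (_∈ E a) (sym (orig-copy b g)) g∈E)) , k≻h
        , lift-feasible a
            (λ l∈ l′∈ → one-copy-added (p─q⊆p (Mₐ* ∪ ⁅ k ⁆) ⁅ h ⁆ l∈) (p─q⊆p (Mₐ* ∪ ⁅ k ⁆) ⁅ h ⁆ l′∈))
            (λ l∈ → let l∈+ , l≢h = x∈p-y⁻ (Mₐ* ∪ ⁅ k ⁆) l∈ in
              x∈p∧x≢y⇒x∈p-y (orig-added l∈+) (λ eq → l≢h (same l∈+ (trans eq (sym (orig-copy b g))))))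
            feas)
        where
        h = copy b g
        same : ∀ {l} → l ∈ Mₐ* ∪ ⁅ k ⁆ → orig l ≡ orig h → l ≡ h
        same l∈ eq with ∈-added l∈
        ... | inj₁ (p , _) = one-copy p h∈M* eq
        ... | inj₂ refl    = contradiction (sym eq) (absurd-orig h∈M*)

    -- On both sides `y e` precedes every copy of a strictly worse contract, so it does not matter
    -- which copy of `g` is in `M*`.
    free-y : ∀ {a e} → e ∉ M → Free M e a → I*.Free M* (y e) a
    free-y e∉M (inj₁ feas) = free-add 1F e∉M feas
    free-y {a} e∉M (inj₂ (g , g∈ , e≻g , feas))
      with g∈M , g∈E ← x∈p∩q⁻ M (E a) g∈ with b , h∈M* ← ∈M⁻ g∈M =
      free-exchange 1F e∉M g∈E h∈M* (y-outranks a b e≻g) feas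

    -- By `free-y`, the y-copy of a contract blocking `M` would block `M*`.
    stable : (∀ e → ¬ I*.Blocks e M*) → Stable M
    stable unblocked = matching , λ e (e∉M , free-W , free-F) → unblocked (y e)
      ( copy∉M* 1F e∉M
      , subst (λ i → I*.Free M* (y e) (inj₁ (∂W i))) (sym (orig-copy 1F e)) (free-y e∉M free-W)
      , subst (λ i → I*.Free M* (y e) (inj₂ (∂F i))) (sym (orig-copy 1F e)) (free-y e∉M free-F))

-- Pairing two matchings on one side of the market

nested-singleton : ∀ (i : Fin n) (L : Subset n) → Nested ⁅ i ⁆ L
nested-singleton i L with i ∈? L
... | yes i∈L = inj₁ λ p → subst (_∈ L) (sym (x∈⁅y⁆⇒x≡y i p)) i∈L
... | no  i∉L = inj₂ (inj₂ λ (k , p) → let k∈i , k∈L = x∈p∩q⁻ ⁅ i ⁆ L p in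
  i∉L (subst (_∈ L) (x∈⁅y⁆⇒x≡y i k∈i) k∈L))

∪-monoˡ-∩ : ∀ (p q r : Subset n) → (p ∩ q) ∪ r ⊆ p ∪ r
∪-monoˡ-∩ p q r i∈ = x∈p∪q⁺ (Sum.map₁ (p∩q⊆p p q) (x∈p∪q⁻ (p ∩ q) r i∈))

-‿mono-⊆ : ∀ {p q : Subset n} x → p ⊆ q → p - x ⊆ q - x
-‿mono-⊆ {p = p} x p⊆q i∈ with i∈p , i≢x ← x∈p-y⁻ p i∈ = x∈p∧x≢y⇒x∈p-y (p⊆q i∈p) i≢x

module Sides {nW nF n : ℕ} (I : SMTI-LC nW nF n) where
  open SMTI-LC I
  open Transfer I

  -- Workers and firms are treated uniformly through this record. `owner` says that distinct agents
  -- of one side have disjoint contract sets.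
  record Side : Set where
    field
      agentOf : Fin n → Agent
      ∈E      : ∀ e → e ∈ E (agentOf e)
      owner   : ∀ {e i} → e ∈ E (agentOf i) → agentOf i ≡ agentOf e

    -- The singletons make a locally maximal pairing pair every common contract with itself.
    family : List (Subset n)
    family = map ⁅_⁆ (allFin n) ++ concatMap (λ i → map proj₁ (𝓛 (agentOf i))) (allFin n)

    singleton∈family : ∀ i → ⁅ i ⁆ ∈ₗ family
    singleton∈family i = ∈-++⁺ˡ (∈-map⁺ ⁅_⁆ (∈-allFin i))

    𝓛⊆family : ∀ i {L q} → (L , q) ∈ₗ 𝓛 (agentOf i) → L ∈ₗ family
    𝓛⊆family i L∈ = ∈-++⁺ʳ (map ⁅_⁆ (allFin n))
      (∈-concatMap⁺ _ (Any.map (λ { refl → ∈-map⁺ proj₁ L∈ }) (∈-allFin i)))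

    ∈-family⁻ : ∀ {L} → L ∈ₗ family → (∃ λ i → L ≡ ⁅ i ⁆) ⊎ (∃ λ i → L ∈ₗ map proj₁ (𝓛 (agentOf i)))
    ∈-family⁻ L∈ with ∈-++⁻ (map ⁅_⁆ (allFin n)) L∈
    ... | inj₁ p with i , _ , eq ← ∈-map⁻ ⁅_⁆ p = inj₁ (i , eq)
    ... | inj₂ p = inj₂ (Any.satisfied (∈-concatMap⁻ _ {xs = allFin n} p))

    𝓛-member⊆E : ∀ a {L} → L ∈ₗ map proj₁ (𝓛 a) → L ⊆ E a
    𝓛-member⊆E a L∈ with (_ , L∈𝓛 , refl) ← ∈-map⁻ proj₁ L∈ = All.lookup (𝓛⊆E a) L∈𝓛

    -- Two quota sets that meet belong to the same agent, by `owner`, and that agent's family is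
    -- laminar.
    family-laminar : Laminar family
    family-laminar {L} {L′} L∈ L′∈ with ∈-family⁻ L∈ | ∈-family⁻ L′∈
    ... | inj₁ (i , refl) | _               = nested-singleton i L′
    ... | inj₂ _          | inj₁ (j , refl) = nested-sym (nested-singleton j L)
    ... | inj₂ (i , p)    | inj₂ (j , q) with nonempty? (L ∩ L′)
    ...   | no  L∩L′≡∅   = inj₂ (inj₂ L∩L′≡∅)
    ...   | yes (k , k∈) with k∈L , k∈L′ ← x∈p∩q⁻ L L′ k∈ =
      𝓛-laminar (agentOf i) p (subst (λ a → L′ ∈ₗ map proj₁ (𝓛 a)) (sym same) q)
      where
      same : agentOf i ≡ agentOf j
      same = trans (owner (𝓛-member⊆E (agentOf i) p k∈L)) (sym (owner (𝓛-member⊆E (agentOf j) q k∈L′)))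

  workerSide firmSide : Side
  workerSide = record
    { agentOf = inj₁ ∘ ∂W
    ; ∈E      = ∈E-∂W
    ; owner   = λ {e} {i} p → cong inj₁ (sym (∈-select⁻ (λ j → ∂W j Fin.≟ ∂W i) p))
    }
  firmSide = record
    { agentOf = inj₂ ∘ ∂F
    ; ∈E      = ∈E-∂F
    ; owner   = λ {e} {i} p → cong inj₂ (sym (∈-select⁻ (λ j → ∂F j Fin.≟ ∂F i) p))
    }

  module SidePairing (side : Side) (N M : Subset n) (N-matching : Matching N) (M-matching : Matching M) where
    open Side side

    private
      greedy = greedyPairing (closeness family) N M

    pairing : Pairing N M
    pairing = proj₁ greedy

    open Pairing pairing public

    locallyMaximal : LocallyMaximal family pairing
    locallyMaximal = greedy⇒locallyMaximal family family-laminar pairing (proj₂ greedy)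

    private
      module NM = Exchange pairing locallyMaximal
      module MN = Exchange (transpose pairing) (transpose-locallyMaximal pairing locallyMaximal)

    self-paired : ∀ {e} → e ∈ N → e ∈ M → e ~ e
    self-paired {e} e∈N e∈M with locallyMaximal (singleton∈family e) e∈N (x∈⁅x⁆ e) e∈M (x∈⁅x⁆ e)
    ... | inj₁ (b , r , b∈e) = subst (e ~_) (x∈⁅y⁆⇒x≡y e b∈e) r
    ... | inj₂ (a , r , a∈e) = subst (_~ e) (x∈⁅y⁆⇒x≡y e a∈e) r

    feasible-exchange : ∀ i {e g} → e ~ g → Feasible (agentOf i) (((M ∩ E (agentOf i)) ∪ ⁅ e ⁆) - g)
    feasible-exchange i {e} {g} r =
      feasible-⊆ a (-‿mono-⊆ g (∪-monoˡ-∩ M (E a) ⁅ e ⁆)) (quota⇒feasible a ((M ∪ ⁅ e ⁆) - g) λ L∈ →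
        NM.exchange (𝓛⊆family i L∈) (feasible⇒quota a N (N-matching a) L∈) (feasible⇒quota a M (M-matching a) L∈) r)
      where a = agentOf i

    -- The transposed pairing is locally maximal too, so the exchange also works inside `N`.
    feasible-exchange′ : ∀ i {e g} → e ~ g → Feasible (agentOf i) (((N ∩ E (agentOf i)) ∪ ⁅ g ⁆) - e)
    feasible-exchange′ i {e} {g} r =
      feasible-⊆ a (-‿mono-⊆ e (∪-monoˡ-∩ N (E a) ⁅ g ⁆)) (quota⇒feasible a ((N ∪ ⁅ g ⁆) - e) λ L∈ →
        MN.exchange (𝓛⊆family i L∈) (feasible⇒quota a M (M-matching a) L∈) (feasible⇒quota a N (N-matching a) L∈) r)
      where a = agentOf i

    -- All quota sets of the agent lie in its contract set, so a partner belonging to another agent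
    -- is outside each of them. This serves unpaired `e` as well as `partner∈E`.
    feasible-add : ∀ i {e} → e ∈ N → (∀ {g} → e ~ g → g ∉ E (agentOf i)) →
                   Feasible (agentOf i) ((M ∩ E (agentOf i)) ∪ ⁅ e ⁆)
    feasible-add i {e} e∈N out =
      feasible-⊆ a (∪-monoˡ-∩ M (E a) ⁅ e ⁆) (quota⇒feasible a (M ∪ ⁅ e ⁆) λ L∈ →
        NM.augment (𝓛⊆family i L∈) (feasible⇒quota a N (N-matching a) L∈) (feasible⇒quota a M (M-matching a) L∈)
          e∈N (λ r g∈L → out r (All.lookup (𝓛⊆E a) L∈ g∈L)))
      where a = agentOf i

    ∣N∣≤∣M∣+∣unpaired∣ : ∀ U → (∀ {e} → e ∈ N → ¬ Paired e → e ∈ U) → ∣ N ∣ ≤ ∣ M ∣ + ∣ U ∣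
    ∣N∣≤∣M∣+∣unpaired∣ U unpaired⊆U = begin
      ∣ N ∣                        ≤⟨ p⊆q⇒∣p∣≤∣q∣ split ⟩
      ∣ select paired? ∪ U ∣       ≤⟨ ∣p∪q∣≤∣p∣+∣q∣ (select paired?) U ⟩
      ∣ select paired? ∣ + ∣ U ∣   ≤⟨ +-monoˡ-≤ ∣ U ∣ (injective⇒∣p∣≤∣q∣ _~_ (select paired?) M partner injective) ⟩
      ∣ M ∣ + ∣ U ∣                ∎
      where
      open ≤-Reasoning
      split : N ⊆ select paired? ∪ U
      split {e} e∈N with paired? e
      ... | yes r = x∈p∪q⁺ (inj₁ (∈-select⁺ paired? r))
      ... | no ¬r = x∈p∪q⁺ (inj₂ (unpaired⊆U e∈N ¬r))
      partner : ∀ {e} → e ∈ select paired? → ∃ λ g → g ∈ M × e ~ g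
      partner e∈ with g , r ← ∈-select⁻ paired? e∈ = g , proj₂ (~⇒∈ r) , r

-- Comparison of the projection with an arbitrary stable matching

module Approximation {nW nF n : ℕ} (I : SMTI-LC nW nF n) (M* : Subset (n * 3))
                     (stable* : SMTI-LC.Stable (auxiliary I) M*)
                     (N : Subset n) (N-stable : SMTI-LC.Stable I N) where
  open SMTI-LC I
  open Copies n
  open Auxiliary I using (P*)
  open Transfer I
  open Sides I
  open Matched M* (proj₁ stable*)

  module PairedW = SidePairing workerSide N M (proj₁ N-stable) matching
  module PairedF = SidePairing firmSide N M (proj₁ N-stable) matching

  NeverBothFree : Side → Side → Set
  NeverBothFree s t = ∀ c {e} → e ∉ M → I*.Free M* (copy c e) (Side.agentOf s e) →
                      ¬ I*.Free M* (copy c e) (Side.agentOf t e)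

  never-both-free : NeverBothFree workerSide firmSide
  never-both-free c {e} e∉M free-W free-F = proj₂ stable* (copy c e)
    ( copy∉M* c e∉M
    , subst (λ i → I*.Free M* (copy c e) (inj₁ (∂W i))) (sym (orig-copy c e)) free-W
    , subst (λ i → I*.Free M* (copy c e) (inj₂ (∂F i))) (sym (orig-copy c e)) free-F)

  -- Here `t` is the side where `e` is unpaired and `s` the side where its partner is studied; both
  -- orders are instantiated below.
  module Half (s t : Side) (never : NeverBothFree s t) where
    open Side s using (agentOf; owner)
    private
      module S = SidePairing s N M (proj₁ N-stable) matching
      module T = SidePairing t N M (proj₁ N-stable) matching

    unpaired∉M : ∀ {e} → e ∈ N → ¬ T.Paired e → e ∉ M
    unpaired∉M e∈N ¬p e∈M = ¬p (_ , T.self-paired e∈N e∈M)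

    -- Pure addition involves no preferences, so every kind of copy is free.
    unpaired⇒free : ∀ c {e} → e ∈ N → ¬ T.Paired e → I*.Free M* (copy c e) (Side.agentOf t e)
    unpaired⇒free c {e} e∈N ¬p =
      free-add c (unpaired∉M e∈N ¬p) (T.feasible-add e e∈N (λ r _ → ¬p (_ , r)))

    unpaired⇒unfree : ∀ c {e} → e ∈ N → ¬ T.Paired e → ¬ I*.Free M* (copy c e) (agentOf e)
    unpaired⇒unfree c e∈N ¬p free = never c (unpaired∉M e∈N ¬p) free (unpaired⇒free c e∈N ¬p)

    -- Unpaired on both sides, `e` could be added on both, and any copy of it would block `M*`; the
    -- y-copy is an arbitrary choice.
    unpaired⇒paired : ∀ {e} → e ∈ N → ¬ T.Paired e → S.Paired e
    unpaired⇒paired {e} e∈N ¬p with S.paired? e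
    ... | yes q = q
    ... | no ¬q = contradiction
      (free-add 1F (unpaired∉M e∈N ¬p) (S.feasible-add e e∈N (λ r _ → ¬q (_ , r))))
      (unpaired⇒unfree 1F e∈N ¬p)

    module _ {e g : Fin n} (e∈N : e ∈ N) (¬p : ¬ T.Paired e) (e~g : e S.~ g) where
      private
        a = agentOf e

      -- If `g` belonged to another agent, `e` could be added for `a` as if it were unpaired.
      partner∈E : g ∈ E a
      partner∈E with g ∈? E a
      ... | yes g∈E = g∈E
      ... | no  g∉E = contradiction
        (free-add 1F (unpaired∉M e∈N ¬p) (S.feasible-add e e∈N (λ r → subst (_∉ E a) (S.functional e~g r) g∉E)))
        (unpaired⇒unfree 1F e∈N ¬p)

      -- A `g` in both `N` and `M` is paired with itself, so injectivity would give `e = g`, putting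
      -- `e` in `M`.
      partner∉N : g ∉ N
      partner∉N g∈N = unpaired∉M e∈N ¬p (subst (_∈ M)
        (S.injective (S.self-paired g∈N (proj₂ (S.~⇒∈ e~g))) e~g) (proj₂ (S.~⇒∈ e~g)))

      -- Otherwise exchanging `g` for `e` would make this copy of `e` free on side `s`, while it is
      -- already free on side `t`.
      not-outranked : ∀ {b} → copy b g ∈ M* → ¬ (P* a ⊢ copy (first a) e ≻ copy b g)
      not-outranked h∈M* k≻h = unpaired⇒unfree (first a) e∈N ¬p
        (free-exchange (first a) (unpaired∉M e∈N ¬p) partner∈E h∈M* k≻h (S.feasible-exchange e e~g))

      partner-not-last : copy (last (agentOf g)) g ∉ M*
      partner-not-last h∈M* = not-outranked (subst (λ a → copy (last a) g ∈ M*) (sym (owner partner∈E)) h∈M*)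
        (first-outranks-last a (Side.∈E s e) partner∈E)

      -- Unless `a` strictly prefers `g` to `e`, the first copy of `e` would outrank `y g`. Given
      -- that preference, `g` can replace `e` in `N`. The double negation avoids deciding
      -- preferences and suffices for a contradiction.
      y-partner-free : y g ∈ M* → ¬ ¬ Free N g (agentOf g)
      y-partner-free h∈M* ¬free = not-outranked h∈M* (first-outranks-y a (Side.∈E s e) partner∈E
        λ g≻e → ¬free (subst (Free N g) (owner partner∈E)
          (inj₂ (e , x∈p∩q⁺ (e∈N , Side.∈E s e) , g≻e , S.feasible-exchange′ e e~g))))

  module HalfW = Half workerSide firmSide never-both-free
  module HalfF = Half firmSide workerSide (λ c e∉M free-F free-W → never-both-free c e∉M free-W free-F)

  UnpairedW UnpairedF : Pred (Fin n) 0ℓ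
  UnpairedW e = e ∈ N × ¬ PairedW.Paired e
  UnpairedF e = e ∈ N × ¬ PairedF.Paired e

  unpairedW? : Decidable₁ UnpairedW
  unpairedW? e = e ∈? N ×-dec ¬? (PairedW.paired? e)

  unpairedF? : Decidable₁ UnpairedF
  unpairedF? e = e ∈? N ×-dec ¬? (PairedF.paired? e)

  -- A common partner would be in M as a y-copy, and would block N.
  no-common-partner : ∀ {e e′ g} → UnpairedF e → e PairedW.~ g → UnpairedW e′ → ¬ (e′ PairedF.~ g)
  no-common-partner (e∈N , ¬p) e~g (e′∈N , ¬p′) e′~g with ∈M⁻ (proj₂ (PairedW.~⇒∈ e~g))
  ... | 0F , x∈M* = HalfF.partner-not-last e′∈N ¬p′ e′~g x∈M*
  ... | 2F , z∈M* = HalfW.partner-not-last e∈N ¬p e~g z∈M*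
  ... | 1F , y∈M* =
    HalfW.y-partner-free e∈N ¬p e~g y∈M* λ free-W →
    HalfF.y-partner-free e′∈N ¬p′ e′~g y∈M* λ free-F →
    proj₂ N-stable _ (HalfW.partner∉N e∈N ¬p e~g , free-W , free-F)

  -- The letters cross: contracts unpaired on the firm side are followed to their worker-side
  -- partners, and conversely for `partnerF?`.
  partnerW? : Decidable₁ (λ g → ∃ λ e → UnpairedF e × e PairedW.~ g)
  partnerW? g = Fin.any? (λ e → unpairedF? e ×-dec e PairedW.~? g)

  partnerF? : Decidable₁ (λ g → ∃ λ e → UnpairedW e × e PairedF.~ g)
  partnerF? g = Fin.any? (λ e → unpairedW? e ×-dec e PairedF.~? g)

  UW UF imageW imageF : Subset n
  UW = select unpairedW?
  UF = select unpairedF?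
  imageW = select partnerW?
  imageF = select partnerF?

  -- A contract unpaired on one side is paired on the other, and pairings are injective.
  ∣UF∣≤∣imageW∣ : ∣ UF ∣ ≤ ∣ imageW ∣
  ∣UF∣≤∣imageW∣ = injective⇒∣p∣≤∣q∣ PairedW._~_ UF imageW
    (λ e∈ → let u = ∈-select⁻ unpairedF? e∈
                g , e~g = uncurry HalfW.unpaired⇒paired u
            in g , ∈-select⁺ partnerW? (_ , u , e~g) , e~g)
    PairedW.injective

  ∣UW∣≤∣imageF∣ : ∣ UW ∣ ≤ ∣ imageF ∣
  ∣UW∣≤∣imageF∣ = injective⇒∣p∣≤∣q∣ PairedF._~_ UW imageF
    (λ e∈ → let u = ∈-select⁻ unpairedW? e∈
                g , e~g = uncurry HalfF.unpaired⇒paired u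
            in g , ∈-select⁺ partnerF? (_ , u , e~g) , e~g)
    PairedF.injective

  images-disjoint : Empty (imageW ∩ imageF)
  images-disjoint (g , g∈) with g∈W , g∈F ← x∈p∩q⁻ imageW imageF g∈
    with _ , u , r ← ∈-select⁻ partnerW? g∈W with _ , u′ , r′ ← ∈-select⁻ partnerF? g∈F = no-common-partner u r u′ r′

  images⊆M : imageW ∪ imageF ⊆ M
  images⊆M g∈ with x∈p∪q⁻ imageW imageF g∈
  ... | inj₁ g∈W with _ , _ , r ← ∈-select⁻ partnerW? g∈W = proj₂ (PairedW.~⇒∈ r)
  ... | inj₂ g∈F with _ , _ , r ← ∈-select⁻ partnerF? g∈F = proj₂ (PairedF.~⇒∈ r)

  2∣N∣≤3∣M∣ : 2 * ∣ N ∣ ≤ 3 * ∣ M ∣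
  2∣N∣≤3∣M∣ = begin
    2 * ∣ N ∣                               ≡⟨ cong (∣ N ∣ +_) (+-identityʳ (∣ N ∣)) ⟩
    -- One summand is bounded through the firm-side pairing, the other through the worker-side
    -- pairing.
    ∣ N ∣ + ∣ N ∣                           ≤⟨ +-mono-≤
      (PairedF.∣N∣≤∣M∣+∣unpaired∣ UF (λ e∈N ¬p → ∈-select⁺ unpairedF? (e∈N , ¬p)))
      (PairedW.∣N∣≤∣M∣+∣unpaired∣ UW (λ e∈N ¬p → ∈-select⁺ unpairedW? (e∈N , ¬p))) ⟩
    (∣ M ∣ + ∣ UF ∣) + (∣ M ∣ + ∣ UW ∣)     ≡⟨ regroup (∣ M ∣) (∣ UF ∣) (∣ UW ∣) ⟩
    2 * ∣ M ∣ + (∣ UF ∣ + ∣ UW ∣)           ≤⟨ +-monoʳ-≤ (2 * ∣ M ∣) (+-mono-≤ ∣UF∣≤∣imageW∣ ∣UW∣≤∣imageF∣) ⟩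
    2 * ∣ M ∣ + (∣ imageW ∣ + ∣ imageF ∣)   ≤⟨ +-monoʳ-≤ (2 * ∣ M ∣) (disjoint⇒∣p∣+∣q∣≤∣p∪q∣ imageW imageF images-disjoint) ⟩
    2 * ∣ M ∣ + ∣ imageW ∪ imageF ∣         ≤⟨ +-monoʳ-≤ (2 * ∣ M ∣) (p⊆q⇒∣p∣≤∣q∣ images⊆M) ⟩
    2 * ∣ M ∣ + ∣ M ∣                       ≡⟨ +-comm (2 * ∣ M ∣) ∣ M ∣ ⟩
    3 * ∣ M ∣                               ∎
    where
    open ≤-Reasoning
    regroup : ∀ a b c → (a + b) + (a + c) ≡ 2 * a + (b + c)
    regroup = solve-∀

theorem1 : ∀ {nW nF n : ℕ} (I : SMTI-LC nW nF n) (M* : Subset (n * 3)) →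
    SMTI-LC.Stable (auxiliary I) M* →
    SMTI-LC.Stable I (Copies.π n M*)
    × (∀ (M-OPT : Subset n) → SMTI-LC.MaxStable I M-OPT →
    2 * ∣ M-OPT ∣ ≤ 3 * ∣ Copies.π n M* ∣)
theorem1 I M* stable* =
    Transfer.Matched.stable I M* (proj₁ stable*) (proj₂ stable*)
  , λ M-OPT (opt-stable , _) → Approximation.2∣N∣≤3∣M∣ I M* stable* M-OPT opt-stable
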